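{- There are $\Pi^0_1$ sets $P,Q\subseteq 2^{\mathbb N}$ such that $P^\frown Q<^1_1 P\cup Q<^1_1 P\oplus Q$.
   Context: For sets $A,B\subseteq\mathbb N^{\mathbb N}$, $A\le^1_1 B$ (Medvedev reducibility) means that there is a partial computable function $\Gamma:\subseteq\mathbb N^{\mathbb N}\to\mathbb N^{\mathbb N}$ defined on all of $B$ with $\Gamma(g)\in A$ for every $g\in B$; $A<^1_1B$ means $A\le^1_1B$ and $B\not\le^1_1A$. A set $P\subseteq 2^{\mathbb N}$ is $\Pi^0_1$ if $P=[T]$, the set of infinite paths of some computable tree $T\subseteq 2^{<\mathbb N}$. With each $\Pi^0_1$ set $P$ (given by an index) a corresponding computable tree $T_P\subseteq 2^{<\mathbb N}$ with $[T_P]=P$ is fixed; $L_P$ denotes the set of leaves (dead ends) of $T_P$, i.e. strings in $T_P$ with no proper extension in $T_P$. For a string $\rho$ and a set $Q$, $\rho^\frown Q=\{\rho^\frown f:f\in Q\}$. The (non-commutative) concatenation is $P^\frown Q=P\cup\bigcup_{\rho\in L_P}\rho^\frown Q$. Also $P\oplus Q=(\langle0\rangle^\frown P)\cup(\langle1\rangle^\frown Q)$. -}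

module Defs where

open import Data.Empty using (⊥)
open import Data.Fin using (Fin; toℕ)
open import Data.Fin.Patterns using (0F; 1F)
open import Data.List using (List; []; _∷_; _++_; applyUpTo)
open import Data.Nat using (ℕ; zero; suc; _+_; _*_; _<_)
open import Data.Product using (Σ-syntax; ∃; ∃-syntax; _×_)
open import Data.Sum using (_⊎_)
open import Data.Unit using (⊤)
open import Data.Vec as Vec using (Vec; lookup)
open import Function using (_∘_)
open import Level using (0ℓ) renaming (suc to lsuc)
open import Relation.Binary.PropositionalEquality using (_≡_; _≗_)
open import Relation.Nullary using (¬_)
open import Relation.Unary using (Pred; _≐_; _∪_)

-- Kleene's μ-recursive functions with oracle symbols drawn from O:
-- Rec ⊥ n are the programs without an oracle, Rec ⊤ n those with a single one.
data Rec (O : Set) : ℕ → Set where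
  zero   : ∀ {n} → Rec O n
  suc    : Rec O 1
  proj   : ∀ {n} → Fin n → Rec O n
  oracle : O → Rec O 1
  comp   : ∀ {m n} → Rec O m → Vec (Rec O n) m → Rec O n
  prec   : ∀ {n} → Rec O n → Rec O (2 + n) → Rec O (1 + n)
  mu     : ∀ {n} → Rec O (1 + n) → Rec O n

-- g ⊢ e · xs ⇓ y : the program e, run on xs with the oracle symbols
-- interpreted by g, halts with value y.
infix 4 _⊢_·_⇓_
data _⊢_·_⇓_ {O : Set} (g : O → ℕ → ℕ) : ∀ {n} → Rec O n → Vec ℕ n → ℕ → Set where
  ⇓-zero   : ∀ {n} {xs : Vec ℕ n} → g ⊢ zero · xs ⇓ 0
  ⇓-suc    : ∀ {x} → g ⊢ suc · Vec.[ x ] ⇓ suc x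
  ⇓-proj   : ∀ {n} {i : Fin n} {xs} → g ⊢ proj i · xs ⇓ lookup xs i
  ⇓-oracle : ∀ {o x} → g ⊢ oracle o · Vec.[ x ] ⇓ g o x
  ⇓-comp   : ∀ {m n} {e : Rec O m} {ds : Vec (Rec O n) m} {xs ys z} →
             (∀ i → g ⊢ lookup ds i · xs ⇓ lookup ys i) →
             g ⊢ e · ys ⇓ z →
             g ⊢ comp e ds · xs ⇓ z
  ⇓-prec₀  : ∀ {n} {d : Rec O n} {e xs y} →
             g ⊢ d · xs ⇓ y →
             g ⊢ prec d e · (0 Vec.∷ xs) ⇓ y
  ⇓-prec₊  : ∀ {n} {d : Rec O n} {e xs k y z} →
             g ⊢ prec d e · (k Vec.∷ xs) ⇓ y →
             g ⊢ e · (k Vec.∷ y Vec.∷ xs) ⇓ z →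
             g ⊢ prec d e · (suc k Vec.∷ xs) ⇓ z
  ⇓-mu     : ∀ {n} {e : Rec O (1 + n)} {xs y} →
             (∀ i → i < y → ∃[ z ] g ⊢ e · (i Vec.∷ xs) ⇓ suc z) →
             g ⊢ e · (y Vec.∷ xs) ⇓ 0 →
             g ⊢ mu e · xs ⇓ y

Baire Cantor String : Set
Baire  = ℕ → ℕ
Cantor = ℕ → Fin 2
String = List (Fin 2)

-- e ⟨ g ⟩≃ h : Γ(g) = h for the partial computable Γ :⊆ Baire → Baire given by
-- e; Γ is defined at g exactly when such an h exists.
infix 4 _⟨_⟩≃_
_⟨_⟩≃_ : Rec ⊤ 1 → Baire → Baire → Set
e ⟨ g ⟩≃ h = ∀ n → (λ _ → g) ⊢ e · Vec.[ n ] ⇓ h n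

infix 4 _≤¹₁_ _<¹₁_
_≤¹₁_ _<¹₁_ : Pred Baire 0ℓ → Pred Baire 0ℓ → Set
A ≤¹₁ B = ∃[ e ] (∀ g → B g → ∃[ h ] (e ⟨ g ⟩≃ h) × A h)
A <¹₁ B = (A ≤¹₁ B) × ¬ (B ≤¹₁ A)

-- A subset of 2^ℕ regarded as a subset of ℕ^ℕ.
infix 9 ↑_
↑_ : Pred Cantor 0ℓ → Pred Baire 0ℓ
(↑ A) g = ∃[ f ] A f × g ≗ toℕ ∘ f

-- Bijective base-2 numeration, a bijection String → ℕ.
⌜_⌝ : String → ℕ
⌜ [] ⌝    = 0
⌜ b ∷ σ ⌝ = 1 + toℕ b + 2 * ⌜ σ ⌝

Computable : Pred String 0ℓ → Set
Computable T = Σ[ e ∈ Rec ⊥ 1 ] ∀ σ →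
  (T σ × (λ ()) ⊢ e · Vec.[ ⌜ σ ⌝ ] ⇓ 1) ⊎ (¬ T σ × (λ ()) ⊢ e · Vec.[ ⌜ σ ⌝ ] ⇓ 0)

IsTree : Pred String 0ℓ → Set
IsTree T = ∀ σ τ → T (σ ++ τ) → T σ

Paths : Pred String 0ℓ → Pred Cantor 0ℓ
Paths T f = ∀ n → T (applyUpTo f n)

Leaf : Pred String 0ℓ → Pred String 0ℓ
Leaf T σ = T σ × (∀ τ → T (σ ++ τ) → τ ≡ [])

-- An inhabitant is an index of P as a Π⁰₁ set; it fixes the tree T_P.
record Π⁰₁ (P : Pred Cantor 0ℓ) : Set (lsuc 0ℓ) where
  field
    tree       : Pred String 0ℓ
    isTree     : IsTree tree
    computable : Computable tree
    paths      : P ≐ Paths tree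

open Π⁰₁ public

infixr 5 _⌢_ _⌢ˢ_
_⌢_ : String → Cantor → Cantor
([] ⌢ f) n            = f n
((b ∷ σ) ⌢ f) zero    = b
((b ∷ σ) ⌢ f) (suc n) = (σ ⌢ f) n

_⌢ˢ_ : String → Pred Cantor 0ℓ → Pred Cantor 0ℓ
(ρ ⌢ˢ Q) g = ∃[ f ] Q f × g ≗ ρ ⌢ f

-- P ⌢⟨ p ⟩ Q is the concatenation of P and Q; it depends on P through T_P,
-- hence on the index p.
infixr 5 _⌢⟨_⟩_
_⌢⟨_⟩_ : (P : Pred Cantor 0ℓ) → Π⁰₁ P → Pred Cantor 0ℓ → Pred Cantor 0ℓ
P ⌢⟨ p ⟩ Q = P ∪ λ g → ∃[ ρ ] Leaf (tree p) ρ × (ρ ⌢ˢ Q) g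

infixr 6 _⊕_
_⊕_ : Pred Cantor 0ℓ → Pred Cantor 0ℓ → Pred Cantor 0ℓ
P ⊕ Q = ((0F ∷ []) ⌢ˢ P) ∪ ((1F ∷ []) ⌢ˢ Q)

-- Split the bits of a sequence into blocks and forbid in each block a few values. P consists
-- of the sequences that respect the blocks of one parity, Q of those that respect the others.
-- Block j is devoted to one program Γ. For each of the finitely many strings σ of length pos j,
-- wait until some value i is found to be unavoidable: whatever few values get forbidden in
-- the blocks above j, some continuation of σ avoids them and makes Γ output i in block j.
-- The first such i is then forbidden in block j. Since a block is much longer than all the
-- previous ones together, the forbidden values never exhaust it. Hence Γ does not map the
-- sequences respecting all blocks except j into those respecting block j; for were no i
-- unavoidable, then by compactness finitely many sets of forbidden values, one for each i,
-- could be avoided simultaneously, and Γ would have no output left. In particular Γ maps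
-- neither P into Q nor Q into P, and this persists under changes of initial segments.
-- A reduction of P ⊕ Q to P ∪ Q settles its first bit on an initial segment of a sequence in
-- P ∩ Q, and then maps Q into P or P into Q. A reduction of P ∪ Q to P ⌢ Q takes some f in P
-- to an element outside Q; beyond the use of this, continue f to a leaf and from there by
-- elements of Q, which are thus mapped into P. The reduction of P ⌢ Q to P ∪ Q copies its
-- input f and starts it afresh once f leaves the tree of P.

module Submission where

open import Defs
open import Algebra.Properties.CommutativeSemigroup using (x∙yz≈y∙xz)
open import Axiom.ExcludedMiddle using (ExcludedMiddle)
open import Data.Empty using (⊥)
open import Data.Fin using (Fin; toℕ; #_)
open import Data.Fin.Patterns using (0F; 1F; 2F)
open import Data.Fin.Properties using (toℕ<n; toℕ-injective)
open import Data.List using (applyUpTo; length; _++_; []; _∷_)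
open import Data.List.Properties using (length-applyUpTo; length-++; applyUpTo-∷ʳ)
open import Data.Nat
open import Data.Nat.Induction using (<-rec)
open import Data.Nat.Properties
open import Data.Product using (Σ-syntax; ∃-syntax; _×_; _,_; proj₁; proj₂; map₂)
open import Data.Sum using (_⊎_; inj₁; inj₂)
open import Data.Unit using (⊤; tt)
open import Data.Vec as Vec using (Vec; []; _∷_; lookup; tabulate)
open import Data.Vec.Properties using (lookup∘tabulate; tabulate∘lookup)
open import Function using (_∘_; id)
open import Level using (0ℓ)
open import Relation.Binary.Definitions using (tri<; tri≈; tri>)
open import Relation.Binary.PropositionalEquality
  using (_≡_; _≢_; _≗_; refl; sym; trans; cong; cong₂; subst; subst₂; module ≡-Reasoning)
open import Relation.Nullary using (¬_; Dec; yes; no; contradiction)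
open import Relation.Nullary.Decidable using (decidable-stable)
open import Relation.Unary using (Pred; _∪_)

-- A language of primitive recursive terms and bounded formulas

⇓-resp : ∀ {O n} {g : O → ℕ → ℕ} {e : Rec O n} {xs y z} → y ≡ z → g ⊢ e · xs ⇓ y → g ⊢ e · xs ⇓ z
⇓-resp refl D = D

-- The program is uniform in `O`: the same characteristic functions decide the trees without an
-- oracle and are evaluated inside the oracle program `reduction`.
record Fun (m : ℕ) : Set₁ where
  field
    fun     : Vec ℕ m → ℕ
    prog    : ∀ {O} → Rec O m
    correct : ∀ {O} {g : O → ℕ → ℕ} xs → g ⊢ prog · xs ⇓ fun xs

open Fun public

data Tm (n : ℕ) : Set₁ where
  var : Fin n → Tm n
  num : ℕ → Tm n
  app : ∀ {m} → Fun m → Vec (Tm n) m → Tm n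
  rec : Tm n → Tm (2 + n) → Tm n → Tm n

natrec : ℕ → (ℕ → ℕ → ℕ) → ℕ → ℕ
natrec z s zero    = z
natrec z s (suc k) = s k (natrec z s k)

⟦_⟧  : ∀ {n} → Tm n → Vec ℕ n → ℕ
⟦_⟧* : ∀ {n m} → Vec (Tm n) m → Vec ℕ n → Vec ℕ m

⟦ var i ⟧ ρ     = lookup ρ i
⟦ num k ⟧ ρ     = k
⟦ app F ts ⟧ ρ  = fun F (⟦ ts ⟧* ρ)
⟦ rec z s t ⟧ ρ = natrec (⟦ z ⟧ ρ) (λ k y → ⟦ s ⟧ (k ∷ y ∷ ρ)) (⟦ t ⟧ ρ)

⟦ [] ⟧* ρ     = []
⟦ t ∷ ts ⟧* ρ = ⟦ t ⟧ ρ ∷ ⟦ ts ⟧* ρ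

constant : ∀ {O n} → ℕ → Rec O n
constant zero    = zero
constant (suc k) = comp suc (constant k ∷ [])

⇓-constant : ∀ {O n} {g : O → ℕ → ℕ} {xs : Vec ℕ n} k → g ⊢ constant k · xs ⇓ k
⇓-constant zero    = ⇓-zero
⇓-constant (suc k) = ⇓-comp {ys = _ ∷ []} (λ { 0F → ⇓-constant k }) ⇓-suc

compile  : ∀ {O n} → Tm n → Rec O n
compile* : ∀ {O n m} → Vec (Tm n) m → Vec (Rec O n) m

compile (var i)     = proj i
compile (num k)     = constant k
compile (app F ts)  = comp (prog F) (compile* ts)
compile (rec z s t) = comp (prec (compile z) (compile s)) (compile t ∷ tabulate proj)

compile* []       = []
compile* (t ∷ ts) = compile t ∷ compile* ts

module _ {O : Set} {g : O → ℕ → ℕ} where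

  ⇓-tabulate-proj : ∀ {n} {xs : Vec ℕ n} i → g ⊢ lookup (tabulate proj) i · xs ⇓ lookup xs i
  ⇓-tabulate-proj i rewrite lookup∘tabulate (proj {O}) i = ⇓-proj

  ⇓-prec : ∀ {n} {d : Rec O n} {e : Rec O (2 + n)} {xs z s} →
           g ⊢ d · xs ⇓ z → (∀ k y → g ⊢ e · (k ∷ y ∷ xs) ⇓ s k y) →
           ∀ k → g ⊢ prec d e · (k ∷ xs) ⇓ natrec z s k
  ⇓-prec D E zero    = ⇓-prec₀ D
  ⇓-prec D E (suc k) = ⇓-prec₊ (⇓-prec D E k) (E k _)

  ⇓-compile  : ∀ {n} (t : Tm n) ρ → g ⊢ compile t · ρ ⇓ ⟦ t ⟧ ρ
  ⇓-compile* : ∀ {n m} (ts : Vec (Tm n) m) ρ i →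
               g ⊢ lookup (compile* ts) i · ρ ⇓ lookup (⟦ ts ⟧* ρ) i

  ⇓-compile (var i)     ρ = ⇓-proj
  ⇓-compile (num k)     ρ = ⇓-constant k
  ⇓-compile (app F ts)  ρ = ⇓-comp (⇓-compile* ts ρ) (correct F (⟦ ts ⟧* ρ))
  ⇓-compile (rec z s t) ρ = ⇓-comp {ys = _ ∷ ρ}
    (λ { 0F → ⇓-compile t ρ ; (Fin.suc i) → ⇓-tabulate-proj i })
    (⇓-prec (⇓-compile z ρ) (λ k y → ⇓-compile s (k ∷ y ∷ ρ)) (⟦ t ⟧ ρ))

  ⇓-compile* (t ∷ ts) ρ Fin.zero    = ⇓-compile t ρ
  ⇓-compile* (t ∷ ts) ρ (Fin.suc i) = ⇓-compile* ts ρ i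

⌊_⌋ : ∀ {n} → Tm n → Fun n
⌊ t ⌋ = record { fun = ⟦ t ⟧ ; prog = compile t ; correct = ⇓-compile t }

infix 0 _computes_by_
_computes_by_ : ∀ {n} (F : Fun n) (f : Vec ℕ n → ℕ) → fun F ≗ f → Fun n
F computes f by eq = record
  { fun = f ; prog = prog F ; correct = λ xs → ⇓-resp (eq xs) (correct F xs) }

v : ∀ m {n} {m<n : _} → Tm n
v m {n} {m<n} = var (#_ m {n} {m<n})

unary : (ℕ → ℕ) → Vec ℕ 1 → ℕ
unary f (x ∷ []) = f x

sucᶠ predᶠ : Fun 1
sucᶠ = record { fun = unary suc ; prog = suc ; correct = λ { (x ∷ []) → ⇓-suc } }
predᶠ = ⌊ rec (num 0) (v 0) (v 0) ⌋ computes unary pred by λ { (zero ∷ []) → refl ; (suc x ∷ []) → refl }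

binary : (ℕ → ℕ → ℕ) → Vec ℕ 2 → ℕ
binary f (x ∷ y ∷ []) = f x y

+ᶠ *ᶠ ∸ᶠ : Fun 2
+ᶠ = ⌊ rec (v 1) (app sucᶠ (v 1 ∷ [])) (v 0) ⌋ computes binary _+_ by λ { (x ∷ y ∷ []) → lem x y }
  where
  lem : ∀ x y → natrec y (λ _ z → suc z) x ≡ x + y
  lem zero    y = refl
  lem (suc x) y = cong suc (lem x y)
*ᶠ = ⌊ rec (num 0) (app +ᶠ (v 3 ∷ v 1 ∷ [])) (v 0) ⌋ computes binary _*_ by λ { (x ∷ y ∷ []) → lem x y }
  where
  lem : ∀ x y → natrec 0 (λ _ z → y + z) x ≡ x * y
  lem zero    y = refl
  lem (suc x) y = cong (y +_) (lem x y)
∸ᶠ = ⌊ rec (v 0) (app predᶠ (v 1 ∷ [])) (v 1) ⌋ computes binary _∸_ by λ { (x ∷ y ∷ []) → lem x y }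
  where
  lem : ∀ x y → natrec x (λ _ z → pred z) y ≡ x ∸ y
  lem x zero    = refl
  lem x (suc y) = trans (cong pred (lem x y)) (pred[m∸n]≡m∸[1+n] x y)

infixl 6 _∔_ _∸̇_
infixl 7 _∗_
_∔_ _∗_ _∸̇_ : ∀ {n} → Tm n → Tm n → Tm n
s ∔ t = app +ᶠ (s ∷ t ∷ [])
s ∗ t = app *ᶠ (s ∷ t ∷ [])
s ∸̇ t = app ∸ᶠ (s ∷ t ∷ [])

1+_ : ∀ {n} → Tm n → Tm n
1+ t = app sucᶠ (t ∷ [])

Reflects01 : Set → ℕ → Set
Reflects01 A c = (A × c ≡ 1) ⊎ (¬ A × c ≡ 0)

record Rel (m : ℕ) : Set₁ where
  field
    rel  : Vec ℕ m → Set
    char : Fun m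
    spec : ∀ xs → Reflects01 (rel xs) (fun char xs)

open Rel public

infix 4 _≐_ _≺_
infixr 3 _∧_
infixr 2 _⇒_
data Fm (n : ℕ) : Set₁ where
  _≐_ _≺_ : Tm n → Tm n → Fm n
  app     : ∀ {m} → Rel m → Vec (Tm n) m → Fm n
  _∧_ _⇒_ : Fm n → Fm n → Fm n
  ∼_      : Fm n → Fm n
  all ex  : Tm n → Fm (1 + n) → Fm n

_⊨_ : ∀ {n} → Vec ℕ n → Fm n → Set
ρ ⊨ (s ≐ t)  = ⟦ s ⟧ ρ ≡ ⟦ t ⟧ ρ
ρ ⊨ (s ≺ t)  = ⟦ s ⟧ ρ < ⟦ t ⟧ ρ
ρ ⊨ app R ts = rel R (⟦ ts ⟧* ρ)
ρ ⊨ (φ ∧ ψ)  = ρ ⊨ φ × ρ ⊨ ψ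
ρ ⊨ (φ ⇒ ψ)  = ρ ⊨ φ → ρ ⊨ ψ
ρ ⊨ (∼ φ)    = ¬ ρ ⊨ φ
ρ ⊨ all t φ  = ∀ x → x < ⟦ t ⟧ ρ → (x ∷ ρ) ⊨ φ
ρ ⊨ ex t φ   = ∃[ x ] x < ⟦ t ⟧ ρ × (x ∷ ρ) ⊨ φ

-- Inside `rec` the context starts with the counter and the accumulated value, while `u` expects the
-- counter only. Applying `⌊ u ⌋` to all variables except `v 1` does the weakening.
product : ∀ {n} → Tm n → Tm (1 + n) → Tm n
product t u = rec (num 1) (v 1 ∗ app ⌊ u ⌋ (v 0 ∷ tabulate (var ∘ Fin.suc ∘ Fin.suc))) t

χ : ∀ {n} → Fm n → Tm n
χ (s ≐ t)    = (num 1 ∸̇ (s ∸̇ t)) ∗ (num 1 ∸̇ (t ∸̇ s))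
χ (s ≺ t)    = num 1 ∸̇ (1+ s ∸̇ t)
χ (app R ts) = app (char R) ts
χ (φ ∧ ψ)    = χ φ ∗ χ ψ
χ (φ ⇒ ψ)    = num 1 ∸̇ χ φ ∗ (num 1 ∸̇ χ ψ)
χ (∼ φ)      = num 1 ∸̇ χ φ
χ (all t φ)  = product t (χ φ)
χ (ex t φ)   = num 1 ∸̇ product t (num 1 ∸̇ χ φ)

dec : ∀ {A c} → Reflects01 A c → Dec A
dec (inj₁ (a , _))  = yes a
dec (inj₂ (¬a , _)) = no ¬a

module _ {A B : Set} where

  reflects-map : (A → B) → (B → A) → ∀ {c} → Reflects01 A c → Reflects01 B c
  reflects-map f g (inj₁ (a , p))  = inj₁ (f a , p)
  reflects-map f g (inj₂ (¬a , p)) = inj₂ (¬a ∘ g , p)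

  reflects-× : ∀ {c d} → Reflects01 A c → Reflects01 B d → Reflects01 (A × B) (c * d)
  reflects-× (inj₁ (a , refl)) (inj₁ (b , refl))  = inj₁ ((a , b) , refl)
  reflects-× (inj₁ (a , refl)) (inj₂ (¬b , refl)) = inj₂ (¬b ∘ proj₂ , refl)
  reflects-× (inj₂ (¬a , refl)) _                 = inj₂ (¬a ∘ proj₁ , refl)

  reflects-→ : ∀ {c d} → Reflects01 A c → Reflects01 B d → Reflects01 (A → B) (1 ∸ c * (1 ∸ d))
  reflects-→ (inj₁ (a , refl)) (inj₁ (b , refl))  = inj₁ ((λ _ → b) , refl)
  reflects-→ (inj₁ (a , refl)) (inj₂ (¬b , refl)) = inj₂ ((λ f → ¬b (f a)) , refl)
  reflects-→ (inj₂ (¬a , refl)) _                 = inj₁ ((λ a → contradiction a ¬a) , refl)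

reflects-¬ : ∀ {A c} → Reflects01 A c → Reflects01 (¬ A) (1 ∸ c)
reflects-¬ (inj₁ (a , refl))  = inj₂ ((λ ¬a → ¬a a) , refl)
reflects-¬ (inj₂ (¬a , refl)) = inj₁ (¬a , refl)

reflects-< : ∀ x y → Reflects01 (x < y) (1 ∸ (suc x ∸ y))
reflects-< x y with x <? y
... | yes x<y = inj₁ (x<y , cong (1 ∸_) (m≤n⇒m∸n≡0 x<y))
... | no  x≮y = inj₂ (x≮y , m≤n⇒m∸n≡0 (m<n⇒0<n∸m (s≤s (≮⇒≥ x≮y))))

reflects-≤ : ∀ x y → Reflects01 (x ≤ y) (1 ∸ (x ∸ y))
reflects-≤ x y = reflects-map s≤s⁻¹ s≤s (reflects-< x (suc y))

natrec-cong : ∀ {z z′ s s′} → z ≡ z′ → (∀ k y → s k y ≡ s′ k y) → natrec z s ≗ natrec z′ s′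
natrec-cong z≡ s≡ zero    = z≡
natrec-cong {s = s} z≡ s≡ (suc k) = trans (cong (s k) (natrec-cong z≡ s≡ k)) (s≡ k _)

reflects-all : ∀ {A : ℕ → Set} {c : ℕ → ℕ} → (∀ x → Reflects01 (A x) (c x)) →
               ∀ n → Reflects01 (∀ x → x < n → A x) (natrec 1 (λ k y → y * c k) n)
reflects-all r zero    = inj₁ ((λ _ ()) , refl)
reflects-all {A} r (suc n) = reflects-map to from (reflects-× (reflects-all r n) (r n))
  where
  to : (∀ x → x < n → A x) × A n → ∀ x → x < suc n → A x
  to (h , a) x x<1+n with m<1+n⇒m<n∨m≡n x<1+n
  ... | inj₁ x<n  = h x x<n
  ... | inj₂ refl = a
  from : (∀ x → x < suc n → A x) → (∀ x → x < n → A x) × A n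
  from h = (λ x x<n → h x (m<n⇒m<1+n x<n)) , h n ≤-refl

⟦vars⟧ : ∀ {n m} (ρ : Vec ℕ n) (f : Fin m → Fin n) → ⟦ tabulate (var ∘ f) ⟧* ρ ≡ tabulate (lookup ρ ∘ f)
⟦vars⟧ {m = zero}  ρ f = refl
⟦vars⟧ {m = suc m} ρ f = cong (lookup ρ (f Fin.zero) ∷_) (⟦vars⟧ ρ (f ∘ Fin.suc))

⟦product⟧ : ∀ {n} (t : Tm n) u ρ →
            ⟦ product t u ⟧ ρ ≡ natrec 1 (λ k y → y * ⟦ u ⟧ (k ∷ ρ)) (⟦ t ⟧ ρ)
⟦product⟧ t u ρ = natrec-cong refl
  (λ k y → cong (λ xs → y * ⟦ u ⟧ (k ∷ xs))
    (trans (⟦vars⟧ (k ∷ y ∷ ρ) (Fin.suc ∘ Fin.suc)) (tabulate∘lookup ρ)))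
  (⟦ t ⟧ ρ)

reflects : ∀ {n} (φ : Fm n) ρ → Reflects01 (ρ ⊨ φ) (⟦ χ φ ⟧ ρ)
reflects (s ≐ t) ρ    = reflects-map (λ (p , q) → ≤-antisym p q) (λ p → ≤-reflexive p , ≤-reflexive (sym p))
                          (reflects-× (reflects-≤ _ _) (reflects-≤ _ _))
reflects (s ≺ t) ρ    = reflects-< _ _
reflects (app R ts) ρ = spec R (⟦ ts ⟧* ρ)
reflects (φ ∧ ψ) ρ    = reflects-× (reflects φ ρ) (reflects ψ ρ)
reflects (φ ⇒ ψ) ρ    = reflects-→ (reflects φ ρ) (reflects ψ ρ)
reflects (∼ φ) ρ      = reflects-¬ (reflects φ ρ)
reflects (all t φ) ρ  = subst (Reflects01 _) (sym (⟦product⟧ t (χ φ) ρ))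
                          (reflects-all (λ x → reflects φ (x ∷ ρ)) (⟦ t ⟧ ρ))
reflects (ex t φ) ρ   = subst (Reflects01 _) (cong (1 ∸_) (sym (⟦product⟧ t (num 1 ∸̇ χ φ) ρ)))
                          (reflects-ex (reflects-all (λ x → reflects-¬ (reflects φ (x ∷ ρ))) (⟦ t ⟧ ρ)))
  where
  reflects-ex : ∀ {n c} → Reflects01 (∀ x → x < n → ¬ (x ∷ ρ) ⊨ φ) c →
                Reflects01 (∃[ x ] x < n × (x ∷ ρ) ⊨ φ) (1 ∸ c)
  reflects-ex (inj₁ (h , refl))      = inj₂ ((λ (x , x<n , p) → h x x<n p) , refl)
  reflects-ex {n} (inj₂ (¬h , refl)) with anyUpTo? (λ x → dec (reflects φ (x ∷ ρ))) n
  ... | yes p = inj₁ (p , refl)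
  ... | no ¬p = contradiction (λ x x<n p → ¬p (x , x<n , p)) ¬h

⟪_⟫ : ∀ {n} → Fm n → Rel n
⟪ φ ⟫ = record { rel = _⊨ φ ; char = ⌊ χ φ ⌋ ; spec = reflects φ }

-- Pairs, strings and blocks as numbers

opaque

  -- Injective but not onto; a polynomial without division that is monotone in both arguments and
  -- bounds both of them.
  pair : ℕ → ℕ → ℕ
  pair a b = (a + b) * (a + b) + a

  pair-def : ∀ a b → (a + b) * (a + b) + a ≡ pair a b
  pair-def a b = refl

  pair-mono : ∀ {a b c d} → a ≤ c → b ≤ d → pair a b ≤ pair c d
  pair-mono p q = +-mono-≤ (*-mono-≤ (+-mono-≤ p q) (+-mono-≤ p q)) p

  -- With s = a + b the code lies between s² and s² + s, hence below (s + 1)².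
  pair-sum-< : ∀ {a b c d} → a + b < c + d → pair a b < pair c d
  pair-sum-< {a} {b} {c} {d} p = begin-strict
    s * s + a           <⟨ +-monoʳ-< (s * s) (s≤s (≤-trans (m≤m+n a b) (m≤m+n s s))) ⟩
    s * s + suc (s + s) ≡⟨ square s ⟨
    suc s * suc s       ≤⟨ *-mono-≤ p p ⟩
    (c + d) * (c + d)   ≤⟨ m≤m+n _ c ⟩
    pair c d            ∎
    where
    open ≤-Reasoning
    s : ℕ
    s = a + b
    square : ∀ s → suc s * suc s ≡ s * s + suc (s + s)
    square s = trans (cong (suc s +_) (*-suc s s)) (trans (+-comm (suc s) (s + s * s))
      (trans (cong (_+ suc s) (+-comm s (s * s))) (trans (+-assoc (s * s) s (suc s)) (cong (s * s +_) (+-suc s s)))))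

  pair-injective : ∀ a b {c d} → pair a b ≡ pair c d → a ≡ c × b ≡ d
  pair-injective a b {c} {d} eq with <-cmp (a + b) (c + d)
  ... | tri< lt _ _ = contradiction eq (<⇒≢ (pair-sum-< {a} {b} {c} {d} lt))
  ... | tri> _ _ gt = contradiction (sym eq) (<⇒≢ (pair-sum-< {c} {d} {a} {b} gt))
  ... | tri≈ _ s _ rewrite s with +-cancelˡ-≡ ((c + d) * (c + d)) a c eq
  ... | refl = refl , +-cancelˡ-≡ a b d s

  ≤-pairˡ : ∀ a b → a ≤ pair a b
  ≤-pairˡ a b = m≤n+m a _

  ≤-pairʳ : ∀ a b → b ≤ pair a b
  ≤-pairʳ a zero    = z≤n
  ≤-pairʳ a (suc b) = begin
    suc b                     ≤⟨ m≤n+m (suc b) a ⟩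
    a + suc b                 ≤⟨ m≤m*n (a + suc b) (a + suc b) {{>-nonZero (≤-trans (s≤s z≤n) (m≤n+m (suc b) a))}} ⟩
    (a + suc b) * (a + suc b) ≤⟨ m≤m+n _ a ⟩
    pair a (suc b)            ∎
    where open ≤-Reasoning

pairᶠ : Fun 2
pairᶠ = ⌊ (v 0 ∔ v 1) ∗ (v 0 ∔ v 1) ∔ v 0 ⌋ computes binary pair by λ { (a ∷ b ∷ []) → pair-def a b }

2^ᶠ : Fun 1
2^ᶠ = ⌊ rec (num 1) (num 2 ∗ v 1) (v 0) ⌋ computes unary (2 ^_) by λ { (k ∷ []) → lem k }
  where
  lem : ∀ k → natrec 1 (λ _ y → 2 * y) k ≡ 2 ^ k
  lem zero    = refl
  lem (suc k) = cong (2 *_) (lem k)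

-- The clause of `⌜_⌝` for nonempty strings, on codes. It also numbers the blocks: block
-- `cons b (code e)` is devoted to the program `e` and the class `b`.
cons : Fin 2 → ℕ → ℕ
cons b r = 1 + toℕ b + 2 * r

opaque

  -- tail c is the code of the tail of the string with code c.
  tail : ℕ → ℕ
  tail = natrec 0 (λ k y → k ∸ suc y)

  drop : ℕ → ℕ → ℕ
  drop x d = natrec d (λ _ y → tail y) x

  -- Bit x of the string with code d, and 0 beyond its end.
  bin : ℕ → ℕ → ℕ
  bin d x = drop x d ∸ 2 * tail (drop x d) ∸ 1

  tail-def : ∀ c → natrec 0 (λ k y → k ∸ suc y) c ≡ tail c
  tail-def c = refl

  drop-def : ∀ x d → natrec d (λ _ y → tail y) x ≡ drop x d
  drop-def x d = refl

  bin-def : ∀ d x → drop x d ∸ 2 * tail (drop x d) ∸ 1 ≡ bin d x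
  bin-def d x = refl

  drop-zero : ∀ d → drop 0 d ≡ d
  drop-zero d = refl

  drop-suc : ∀ x d → drop (suc x) d ≡ drop x (tail d)
  drop-suc zero    d = refl
  drop-suc (suc x) d = cong tail (drop-suc x d)

  -- Consecutive values of `tail` determine each other, `tail (suc k)` being k ∸ 1 ∸ `tail k`; so
  -- the two parities are proved by simultaneous induction.
  tail-odd : ∀ r → tail (1 + (r + r)) ≡ r
  tail-even : ∀ r → tail (2 + (r + r)) ≡ r
  tail-odd zero    = refl
  tail-odd (suc r) rewrite +-suc r r | tail-even r =
    trans (+-∸-assoc 1 (m≤m+n r r)) (cong suc (m+n∸m≡n r r))
  tail-even r rewrite tail-odd r = m+n∸m≡n r r

tail-cons : ∀ b r → tail (cons b r) ≡ r
tail-cons 0F r rewrite +-identityʳ r = tail-odd r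
tail-cons 1F r rewrite +-identityʳ r = tail-even r

opaque
  unfolding tail

  bin-zero : ∀ d → bin d 0 ≡ d ∸ 2 * tail d ∸ 1
  bin-zero d = refl

  bin-suc′ : ∀ d x → bin d (suc x) ≡ bin (tail d) x
  bin-suc′ d x = cong (λ z → z ∸ 2 * tail z ∸ 1) (drop-suc x d)

  tail-zero : tail 0 ≡ 0
  tail-zero = refl

tailᶠ : Fun 1
tailᶠ = ⌊ rec (num 0) (v 0 ∸̇ 1+ v 1) (v 0) ⌋ computes unary tail by λ { (c ∷ []) → tail-def c }

dropᶠ binᶠ : Fun 2
dropᶠ = ⌊ rec (v 1) (app tailᶠ (v 1 ∷ [])) (v 0) ⌋ computes binary drop by λ { (x ∷ d ∷ []) → drop-def x d }
binᶠ = ⌊ app dropᶠ (v 1 ∷ v 0 ∷ []) ∸̇ num 2 ∗ app tailᶠ (app dropᶠ (v 1 ∷ v 0 ∷ []) ∷ []) ∸̇ num 1 ⌋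
  computes binary bin by λ { (d ∷ x ∷ []) → bin-def d x }

bin-cons : ∀ b r → bin (cons b r) 0 ≡ toℕ b
bin-cons b r rewrite bin-zero (cons b r) | tail-cons b r = cong (_∸ 1) (m+n∸n≡m (1 + toℕ b) (2 * r))

bin-cons-suc : ∀ b r x → bin (cons b r) (suc x) ≡ bin r x
bin-cons-suc b r x = trans (bin-suc′ (cons b r) x) (cong (λ d → bin d x) (tail-cons b r))

cons-elim : ∀ c → c ≡ 0 ⊎ ∃[ b ] ∃[ r ] c ≡ cons b r
cons-elim zero = inj₁ refl
cons-elim (suc c) with cons-elim c
... | inj₁ refl            = inj₂ (0F , 0 , refl)
... | inj₂ (0F , r , refl) = inj₂ (1F , r , refl)
... | inj₂ (1F , r , refl) = inj₂ (0F , suc r , cong (2 +_) (sym (+-suc r (r + 0))))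

bin≤1 : ∀ d x → bin d x ≤ 1
bin≤1 d zero with cons-elim d
... | inj₁ refl rewrite bin-zero 0 | tail-zero = z≤n
... | inj₂ (b , r , refl) rewrite bin-cons b r = s≤s⁻¹ (toℕ<n b)
bin≤1 d (suc x) rewrite bin-suc′ d x = bin≤1 (tail d) x

bin-string : ∀ f {n x} → x < n → bin ⌜ applyUpTo f n ⌝ x ≡ toℕ (f x)
bin-string f {suc n} {zero}  _       = bin-cons (f 0) ⌜ applyUpTo (f ∘ suc) n ⌝
bin-string f {suc n} {suc x} (s≤s p) =
  trans (bin-cons-suc (f 0) ⌜ applyUpTo (f ∘ suc) n ⌝ x) (bin-string (f ∘ suc) p)

drop-of-zero : ∀ x → drop x 0 ≡ 0
drop-of-zero zero    = drop-zero 0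
drop-of-zero (suc x) = trans (drop-suc x 0) (trans (cong (drop x) tail-zero) (drop-of-zero x))

-- Only the empty string has code 0. Thus the length of a string can be read off its code, which is
-- how the trees are decided.
drop-string : ∀ σ x → drop x ⌜ σ ⌝ ≢ 0 → x < length σ
drop-string []      zero    h = contradiction (drop-zero 0) h
drop-string []      (suc x) h = contradiction (drop-of-zero (suc x)) h
drop-string (b ∷ σ) zero    h = s≤s z≤n
drop-string (b ∷ σ) (suc x) h =
  s≤s (drop-string σ x (λ p → h (trans (drop-suc x (cons b ⌜ σ ⌝)) (trans (cong (drop x) (tail-cons b ⌜ σ ⌝)) p))))

<length⇒drop : ∀ σ x → x < length σ → drop x ⌜ σ ⌝ ≢ 0
<length⇒drop (b ∷ σ) zero    _       p = contradiction (trans (sym (drop-zero (cons b ⌜ σ ⌝))) p) λ ()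
<length⇒drop (b ∷ σ) (suc x) (s≤s q) p = <length⇒drop σ x q
  (trans (sym (trans (drop-suc x (cons b ⌜ σ ⌝)) (cong (drop x) (tail-cons b ⌜ σ ⌝)))) p)

length≤⌜⌝ : ∀ σ → length σ ≤ ⌜ σ ⌝
length≤⌜⌝ []      = z≤n
length≤⌜⌝ (b ∷ σ) = s≤s (begin
  length σ              ≤⟨ length≤⌜⌝ σ ⟩
  ⌜ σ ⌝                 ≤⟨ m≤n*m ⌜ σ ⌝ 2 ⟩
  2 * ⌜ σ ⌝             ≤⟨ m≤n+m _ (toℕ b) ⟩
  toℕ b + 2 * ⌜ σ ⌝     ∎)
  where open ≤-Reasoning

-- The sharp bound, attained by strings of ones; the weaker `⌜⌝<2^` would not pass through the
-- induction.
2+⌜⌝≤2^ : ∀ σ → 2 + ⌜ σ ⌝ ≤ 2 ^ suc (length σ)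
2+⌜⌝≤2^ []      = ≤-refl
2+⌜⌝≤2^ (b ∷ σ) = begin
  3 + toℕ b + 2 * ⌜ σ ⌝    ≤⟨ +-monoˡ-≤ (2 * ⌜ σ ⌝) (+-monoʳ-≤ 2 (toℕ<n b)) ⟩
  4 + 2 * ⌜ σ ⌝            ≡⟨ *-distribˡ-+ 2 2 ⌜ σ ⌝ ⟨
  2 * (2 + ⌜ σ ⌝)          ≤⟨ *-monoʳ-≤ 2 (2+⌜⌝≤2^ σ) ⟩
  2 ^ suc (suc (length σ)) ∎
  where open ≤-Reasoning

⌜⌝<2^ : ∀ σ → ⌜ σ ⌝ < 2 ^ suc (length σ)
⌜⌝<2^ σ = ≤-trans (n≤1+n _) (2+⌜⌝≤2^ σ)

opaque

  -- Block k consists of the width (pos k) bits from pos k on. All strings of length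
  -- at most pos k have codes below branch (pos k).
  branch : ℕ → ℕ
  branch q = 2 ^ suc q

  -- Room for a bit number `pair i a` for all i and a up to `branch q`; `Construct` reserves that
  -- bit for value number a of the i-th collection of forbidden values.
  width : ℕ → ℕ
  width q = suc (pair (branch q) (branch q))

  pos : ℕ → ℕ
  pos zero    = 0
  pos (suc k) = pos k + width (pos k)

  branch-def : ∀ q → 2 ^ suc q ≡ branch q
  branch-def q = refl

  width-def : ∀ q → suc (pair (branch q) (branch q)) ≡ width q
  width-def q = refl

  pos-suc : ∀ k → pos (suc k) ≡ pos k + width (pos k)
  pos-suc k = refl

  pos-def : ∀ k → natrec 0 (λ _ q → q + width q) k ≡ pos k
  pos-def zero    = refl
  pos-def (suc k) = cong (λ q → q + width q) (pos-def k)

  branch-mono : ∀ {p q} → p ≤ q → branch p ≤ branch q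
  branch-mono p≤q = ^-monoʳ-≤ 2 (s≤s p≤q)

  pair<width : ∀ {a b q} → a ≤ branch q → b ≤ branch q → pair a b < width q
  pair<width p q = s≤s (pair-mono p q)

  branch<width : ∀ q → branch q < width q
  branch<width q = s≤s (≤-pairˡ (branch q) (branch q))

branchᶠ widthᶠ posᶠ : Fun 1
branchᶠ = ⌊ app 2^ᶠ (1+ v 0 ∷ []) ⌋ computes unary branch by λ { (q ∷ []) → branch-def q }
widthᶠ = ⌊ 1+ app pairᶠ (app branchᶠ (v 0 ∷ []) ∷ app branchᶠ (v 0 ∷ []) ∷ []) ⌋
  computes unary width by λ { (q ∷ []) → width-def q }
posᶠ = ⌊ rec (num 0) (v 1 ∔ app widthᶠ (v 1 ∷ [])) (v 0) ⌋ computes unary pos by λ { (k ∷ []) → pos-def k }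

string<branch : ∀ f {n q} → n ≤ q → ⌜ applyUpTo f n ⌝ < branch q
string<branch f {n} {q} n≤q = begin-strict
  ⌜ applyUpTo f n ⌝            <⟨ ⌜⌝<2^ (applyUpTo f n) ⟩
  2 ^ suc (length (applyUpTo f n)) ≡⟨ cong (λ m → 2 ^ suc m) (length-applyUpTo f n) ⟩
  2 ^ suc n                    ≡⟨ branch-def n ⟩
  branch n                     ≤⟨ branch-mono n≤q ⟩
  branch q                     ∎
  where open ≤-Reasoning

n≤pos : ∀ k → k ≤ pos k
n≤pos zero    = z≤n
n≤pos (suc k) rewrite pos-suc k | sym (width-def (pos k)) | +-suc (pos k) (pair (branch (pos k)) (branch (pos k))) =
  s≤s (≤-trans (n≤pos k) (m≤m+n _ _))

pos-≤-suc : ∀ k → pos k ≤ pos (suc k)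
pos-≤-suc k rewrite pos-suc k = m≤m+n _ _

pos-mono : ∀ {j k} → j ≤ k → pos j ≤ pos k
pos-mono {k = zero} z≤n = ≤-refl
pos-mono {j} {suc k} j≤1+k with m≤n⇒m<n∨m≡n j≤1+k
... | inj₁ (s≤s j≤k) = ≤-trans (pos-mono j≤k) (pos-≤-suc k)
... | inj₂ refl = ≤-refl

width≤pos : ∀ k → width (pos k) ≤ pos (suc k)
width≤pos k rewrite pos-suc k = m≤n+m _ (pos k)

block<pos : ∀ {k x} → x < width (pos k) → pos k + x < pos (suc k)
block<pos {k} x< rewrite pos-suc k = +-monoʳ-< (pos k) x<

block-injective : ∀ {j k x y} → x < width (pos j) → y < width (pos k) →
                  pos j + x ≡ pos k + y → j ≡ k × x ≡ y
block-injective {j} {k} {x} {y} x< y< eq with <-cmp j k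
... | tri< j<k _ _ = contradiction eq (<⇒≢ (<-≤-trans (block<pos {j} x<) (≤-trans (pos-mono j<k) (m≤m+n _ y))))
... | tri> _ _ k<j = contradiction (sym eq) (<⇒≢ (<-≤-trans (block<pos {k} y<) (≤-trans (pos-mono k<j) (m≤m+n _ x))))
... | tri≈ _ refl _ = refl , +-cancelˡ-≡ (pos j) x y eq

-- Finite sets of facts about oracle computations

vec : ∀ {n} → Vec ℕ n → ℕ
vec []       = 0
vec (x ∷ xs) = pair x (vec xs)

-- Projections are coded in unary: tag 3 discards one argument and tag 2 returns the first, so each
-- has a rule that takes apart a single pair.
pcode : ∀ {n} → Fin n → ℕ
pcode Fin.zero    = pair 2 0
pcode (Fin.suc i) = pair 3 (pcode i)

code  : ∀ {n} → Rec ⊤ n → ℕ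
code* : ∀ {n m} → Vec (Rec ⊤ n) m → ℕ

code zero        = pair 0 0
code suc         = pair 1 0
code (proj i)    = pcode i
code (oracle _)  = pair 4 0
code (comp e ds) = pair 5 (pair (code e) (code* ds))
code (prec d e)  = pair 8 (pair (code d) (code e))
code (mu e)      = pair 9 (code e)

code* []       = pair 6 0
code* (d ∷ ds) = pair 7 (pair (code d) (code* ds))

fact : ℕ → ℕ → ℕ → ℕ
fact c x y = pair c (pair x y)

∃<_,_ : ℕ → (ℕ → Set) → Set
∃< N , A = ∃[ a ] a < N × A a

-- The clause of _⊢_·_⇓_ for programs with tag t, over a set M of facts
-- (program, arguments, value) and the oracle α below n. Tags 6 and 7 belong to
-- vectors of programs; N bounds the quantifiers to make the clauses decidable.
Rule : (M : ℕ → ℕ → ℕ → Set) (N : ℕ) (α : ℕ → ℕ) (n : ℕ) → ℕ → ℕ → ℕ → ℕ → Set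
Rule M N α n 0 r x y = y ≡ 0
Rule M N α n 1 r x y = ∃< N , λ a → x ≡ pair a 0 × y ≡ suc a
Rule M N α n 2 r x y = ∃< N , λ a → x ≡ pair y a
Rule M N α n 3 r x y = ∃< N , λ a → ∃< N , λ b → x ≡ pair a b × M r b y
Rule M N α n 4 r x y = ∃< N , λ a → x ≡ pair a 0 × a < n × y ≡ α a
Rule M N α n 5 r x y = ∃< N , λ a → ∃< N , λ b → ∃< N , λ c → r ≡ pair a b × M b x c × M a c y
Rule M N α n 6 r x y = y ≡ 0
Rule M N α n 7 r x y = ∃< N , λ a → ∃< N , λ b → ∃< N , λ c → ∃< N , λ d →
  r ≡ pair a b × y ≡ pair c d × M a x c × M b x d
Rule M N α n 8 r x y = ∃< N , λ a → ∃< N , λ b → ∃< N , λ k → ∃< N , λ c →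
  r ≡ pair a b × x ≡ pair k c × (k ≡ 0 → M a c y) ×
  -- The guarded quantifier over i < k names the predecessor of k within bounded formulas;
  -- `pair 8 r` is the program itself.
  (∀ i → i < k → k ≡ suc i → ∃< N , λ z → M (pair 8 r) (pair i c) z × M b (pair i (pair z c)) y)
Rule M N α n 9 r x y = M r (pair y x) 0 × (∀ i → i < y → ∃< N , λ z → M r (pair i x) (suc z))
Rule M N α n _ r x y = ⊤

factᶠ : Fun 3
factᶠ = ⌊ app pairᶠ (v 0 ∷ app pairᶠ (v 1 ∷ v 2 ∷ []) ∷ []) ⌋
  computes (λ { (c ∷ x ∷ y ∷ []) → fact c x y }) by λ { (c ∷ x ∷ y ∷ []) → refl }

-- The string with code L is the characteristic string of a finite set of facts. In `Valid`, N also
-- bounds the quantifiers of the rules.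
In : ℕ → ℕ → ℕ → ℕ → ℕ → Set
In L N c x y = bin L (fact c x y) ≡ 1 × fact c x y < N

inF : Fm 5
inF = app binᶠ (v 0 ∷ app factᶠ (v 2 ∷ v 3 ∷ v 4 ∷ []) ∷ []) ≐ num 1 ∧ app factᶠ (v 2 ∷ v 3 ∷ v 4 ∷ []) ≺ v 1

inR : Rel 5
inR = ⟪ inF ⟫

infix 9 _∶_
_∶_ : ∀ {n} → Tm n → Tm n → Tm n
s ∶ t = app pairᶠ (s ∷ t ∷ [])

-- The variables are t r x y L N τ n.
ruleF : Fm 8
ruleF =
  (v 0 ≐ num 0 ⇒ v 3 ≐ num 0) ∧
  (v 0 ≐ num 1 ⇒ ex (v 5) (v 3 ≐ v 0 ∶ num 0 ∧ v 4 ≐ 1+ v 0)) ∧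
  (v 0 ≐ num 2 ⇒ ex (v 5) (v 3 ≐ v 4 ∶ v 0)) ∧
  (v 0 ≐ num 3 ⇒ ex (v 5) (ex (v 6) (v 4 ≐ v 1 ∶ v 0 ∧ app inR (v 6 ∷ v 7 ∷ v 3 ∷ v 0 ∷ v 5 ∷ [])))) ∧
  (v 0 ≐ num 4 ⇒ ex (v 5) (v 3 ≐ v 0 ∶ num 0 ∧ v 0 ≺ v 8 ∧ v 4 ≐ app binᶠ (v 7 ∷ v 0 ∷ []))) ∧
  (v 0 ≐ num 5 ⇒ ex (v 5) (ex (v 6) (ex (v 7) (v 4 ≐ v 2 ∶ v 1 ∧
     app inR (v 7 ∷ v 8 ∷ v 1 ∷ v 5 ∷ v 0 ∷ []) ∧ app inR (v 7 ∷ v 8 ∷ v 2 ∷ v 0 ∷ v 6 ∷ []))))) ∧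
  (v 0 ≐ num 6 ⇒ v 3 ≐ num 0) ∧
  (v 0 ≐ num 7 ⇒ ex (v 5) (ex (v 6) (ex (v 7) (ex (v 8) (v 5 ≐ v 3 ∶ v 2 ∧ v 7 ≐ v 1 ∶ v 0 ∧
     app inR (v 8 ∷ v 9 ∷ v 3 ∷ v 6 ∷ v 1 ∷ []) ∧ app inR (v 8 ∷ v 9 ∷ v 2 ∷ v 6 ∷ v 0 ∷ [])))))) ∧
  (v 0 ≐ num 8 ⇒ ex (v 5) (ex (v 6) (ex (v 7) (ex (v 8) (v 5 ≐ v 3 ∶ v 2 ∧ v 6 ≐ v 1 ∶ v 0 ∧
     (v 1 ≐ num 0 ⇒ app inR (v 8 ∷ v 9 ∷ v 3 ∷ v 0 ∷ v 7 ∷ [])) ∧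
     all (v 1) (v 2 ≐ 1+ v 0 ⇒ ex (v 10) (
       app inR (v 10 ∷ v 11 ∷ num 8 ∶ v 7 ∷ v 1 ∶ v 2 ∷ v 0 ∷ []) ∧
       app inR (v 10 ∷ v 11 ∷ v 4 ∷ v 1 ∶ (v 0 ∶ v 2) ∷ v 9 ∷ [])))))))) ∧
  (v 0 ≐ num 9 ⇒ app inR (v 4 ∷ v 5 ∷ v 1 ∷ v 3 ∶ v 2 ∷ num 0 ∷ []) ∧
     all (v 3) (ex (v 6) (app inR (v 6 ∷ v 7 ∷ v 3 ∷ v 1 ∶ v 4 ∷ 1+ v 0 ∷ []))))

module _ {L N τ n r x y : ℕ} where

  ruleF⇒Rule : ∀ t → (t ∷ r ∷ x ∷ y ∷ L ∷ N ∷ τ ∷ n ∷ []) ⊨ ruleF → Rule (In L N) N (bin τ) n t r x y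
  ruleF⇒Rule 0 (h , _) = h refl
  ruleF⇒Rule 1 (_ , h , _) = h refl
  ruleF⇒Rule 2 (_ , _ , h , _) = h refl
  ruleF⇒Rule 3 (_ , _ , _ , h , _) = h refl
  ruleF⇒Rule 4 (_ , _ , _ , _ , h , _) = h refl
  ruleF⇒Rule 5 (_ , _ , _ , _ , _ , h , _) = h refl
  ruleF⇒Rule 6 (_ , _ , _ , _ , _ , _ , h , _) = h refl
  ruleF⇒Rule 7 (_ , _ , _ , _ , _ , _ , _ , h , _) = h refl
  ruleF⇒Rule 8 (_ , _ , _ , _ , _ , _ , _ , _ , h , _) = h refl
  ruleF⇒Rule 9 (_ , _ , _ , _ , _ , _ , _ , _ , _ , h) = h refl
  ruleF⇒Rule (suc (suc (suc (suc (suc (suc (suc (suc (suc (suc t)))))))))) _ = tt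

  Rule⇒ruleF : ∀ t → Rule (In L N) N (bin τ) n t r x y → (t ∷ r ∷ x ∷ y ∷ L ∷ N ∷ τ ∷ n ∷ []) ⊨ ruleF
  Rule⇒ruleF t h = (λ { refl → h }) , (λ { refl → h }) , (λ { refl → h }) , (λ { refl → h }) , (λ { refl → h }) ,
    (λ { refl → h }) , (λ { refl → h }) , (λ { refl → h }) , (λ { refl → h }) , λ { refl → h }

module _ {M M′ : ℕ → ℕ → ℕ → Set} {N N′ n n′ : ℕ} {α : ℕ → ℕ}
         (M⊆ : ∀ {c x y} → M c x y → M′ c x y) (N≤ : N ≤ N′) (n≤ : n ≤ n′) where

  ∃<-mono : ∀ {A B : ℕ → Set} → (∀ {a} → A a → B a) → ∃< N , A → ∃< N′ , B
  ∃<-mono f (a , a< , p) = a , <-≤-trans a< N≤ , f p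

  Rule-mono : ∀ t {r x y} → Rule M N α n t r x y → Rule M′ N′ α n′ t r x y
  Rule-mono 0 h = h
  Rule-mono 1 h = ∃<-mono id h
  Rule-mono 2 h = ∃<-mono id h
  Rule-mono 3 h = ∃<-mono (∃<-mono (map₂ M⊆)) h
  Rule-mono 4 h = ∃<-mono (λ (p , q , s) → p , <-≤-trans q n≤ , s) h
  Rule-mono 5 h = ∃<-mono (∃<-mono (∃<-mono λ (p , q , s) → p , M⊆ q , M⊆ s)) h
  Rule-mono 6 h = h
  Rule-mono 7 h = ∃<-mono (∃<-mono (∃<-mono (∃<-mono λ (p , p′ , q , s) → p , p′ , M⊆ q , M⊆ s))) h
  Rule-mono 8 h = ∃<-mono (∃<-mono (∃<-mono (∃<-mono λ (p , p′ , q , s) → p , p′ , M⊆ ∘ q ,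
    λ i i< e → ∃<-mono (λ (q , q′) → M⊆ q , M⊆ q′) (s i i< e)))) h
  Rule-mono 9 (p , h) = M⊆ p , λ i i< → ∃<-mono M⊆ (h i i<)
  Rule-mono (suc (suc (suc (suc (suc (suc (suc (suc (suc (suc t)))))))))) _ = tt

-- A set of facts need not be well-founded to determine values: the induction is on the derivation.
module Soundness {M : ℕ → ℕ → ℕ → Set} {N n : ℕ} {α g : ℕ → ℕ} (agree : ∀ a → a < n → g a ≡ α a)
  (closed : ∀ t r x y → M (pair t r) x y → Rule M N α n t r x y) where

  sound-proj : ∀ {m} (i : Fin m) (xs : Vec ℕ m) {y} → M (pcode i) (vec xs) y → y ≡ lookup xs i
  sound-proj 0F (x ∷ xs) h with closed 2 _ _ _ h
  ... | a , _ , eq = sym (proj₁ (pair-injective x (vec xs) eq))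
  sound-proj (Fin.suc i) (x ∷ xs) h with closed 3 _ _ _ h
  ... | a , _ , b , _ , eq , h′ with pair-injective x (vec xs) eq
  ... | refl , refl = sound-proj i xs h′

  sound* : ∀ {m k} (ds : Vec (Rec ⊤ k) m) {xs : Vec ℕ k} {ys : Vec ℕ m} →
           (∀ i y → M (code (lookup ds i)) (vec xs) y → y ≡ lookup ys i) →
           ∀ {z} → M (code* ds) (vec xs) z → z ≡ vec ys
  sound* [] {ys = []} ih h = closed 6 _ _ _ h
  sound* (d ∷ ds) {xs} {y ∷ ys} ih h with closed 7 _ _ _ h
  ... | a , _ , b , _ , c , _ , z , _ , eq , refl , h₁ , h₂ with pair-injective (code d) (code* ds) eq
  ... | refl , refl = cong₂ pair (ih 0F c h₁) (sound* ds {xs} {ys} (ih ∘ Fin.suc) h₂)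

  sound : ∀ {k} {e : Rec ⊤ k} {xs y z} → (λ _ → g) ⊢ e · xs ⇓ y → M (code e) (vec xs) z → z ≡ y
  sound ⇓-zero h = closed 0 _ _ _ h
  sound (⇓-suc {x}) h with closed 1 _ _ _ h
  ... | a , _ , eq , refl = cong suc (sym (proj₁ (pair-injective x 0 eq)))
  sound (⇓-proj {i = i} {xs}) h = sound-proj i xs h
  sound (⇓-oracle {x = x}) h with closed 4 _ _ _ h
  ... | a , _ , eq , a<n , refl with pair-injective x 0 eq
  ... | refl , _ = sym (agree a a<n)
  sound (⇓-comp {e = e} {ds} {xs} {ys} D E) h with closed 5 _ _ _ h
  ... | a , _ , b , _ , c , _ , eq , h₁ , h₂ with pair-injective (code e) (code* ds) eq
  ... | refl , refl with sound* ds {xs} {ys} (λ i y → sound (D i)) h₁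
  ... | refl = sound E h₂
  sound (⇓-prec₀ {d = d} {e} {xs} D) h with closed 8 _ _ _ h
  ... | a , _ , b , _ , k , _ , c , _ , eq , eq′ , h₁ , _
    with pair-injective (code d) (code e) eq | pair-injective 0 (vec xs) eq′
  ... | refl , refl | refl , refl = sound D (h₁ refl)
  sound (⇓-prec₊ {d = d} {e} {xs} {k} D E) h with closed 8 _ _ _ h
  ... | a , _ , b , _ , _ , _ , c , _ , eq , eq′ , _ , h₁
    with pair-injective (code d) (code e) eq | pair-injective (suc k) (vec xs) eq′
  ... | refl , refl | refl , refl with h₁ k ≤-refl refl
  ... | z , _ , h₂ , h₃ with sound D h₂
  ... | refl = sound E h₃
  sound {z = z} (⇓-mu {y = y} D E) h with closed 9 _ _ _ h
  ... | h₁ , h₂ with <-cmp z y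
  ... | tri≈ _ refl _ = refl
  ... | tri< z<y _ _  = contradiction (sound (proj₂ (D z z<y)) h₁) λ ()
  ... | tri> _ _ y<z  with h₂ y y<z
  ... | w , _ , h₃    = contradiction (sound E h₃) λ ()

-- Every halting computation lies in a finite closed set of facts

opaque
  unfolding pair
  fact-injective : ∀ {c x y c′ x′ y′} → fact c x y ≡ fact c′ x′ y′ → c ≡ c′ × x ≡ x′ × y ≡ y′
  fact-injective {c} {x} {y} eq =
    let (p , q) = pair-injective c (pair x y) eq in p , pair-injective x y q

pair<ˡ : ∀ {a b N} → pair a b < N → a < N
pair<ˡ p = ≤-<-trans (≤-pairˡ _ _) p

pair<ʳ : ∀ {a b N} → pair a b < N → b < N
pair<ʳ p = ≤-<-trans (≤-pairʳ _ _) p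

module _ {c x y N : ℕ} (f< : fact c x y < N) where

  code< : c < N
  code< = pair<ˡ f<

  arg< : x < N
  arg< = pair<ˡ (pair<ʳ f<)

  val< : y < N
  val< = pair<ʳ (pair<ʳ f<)

module Completeness (g : ℕ → ℕ) where

  -- The rules hold for every N above the bound, so that sets with different bounds can be united.
  record Closed (S : ℕ → Set) : Set where
    constructor closed-set
    field
      {bound use} : ℕ
      bounded : ∀ {f} → S f → f < bound
      closed  : ∀ t r x y → S (fact (pair t r) x y) → ∀ N → bound ≤ N →
                Rule (λ c x y → S (fact c x y)) N g use t r x y

  open Closed

  -- Sets are predicates at this point, because these are easy to unite; `derivable⇒valid` replaces
  -- them by codes.
  Derivable : (ℕ → Set) → Set₁
  Derivable A = Σ[ S ∈ (ℕ → Set) ] Closed S × (∀ {f} → A f → S f)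

  derivable-∪ : ∀ {A B} → Derivable A → Derivable B → Derivable (λ f → A f ⊎ B f)
  derivable-∪ (S , C , A⊆) (S′ , C′ , B⊆) =
    (λ f → S f ⊎ S′ f) ,
    closed-set {bound = bound C ⊔ bound C′} {use C ⊔ use C′}
      (λ { (inj₁ s) → <-≤-trans (bounded C s) (m≤m⊔n _ _)
         ; (inj₂ s) → <-≤-trans (bounded C′ s) (m≤n⊔m (bound C) _) })
      (λ { t r x y (inj₁ s) N N≥ → Rule-mono inj₁ ≤-refl (m≤m⊔n _ _) t (closed C t r x y s N (m⊔n≤o⇒m≤o _ _ N≥))
         ; t r x y (inj₂ s) N N≥ → Rule-mono inj₂ ≤-refl (m≤n⊔m (use C) _) t
                                     (closed C′ t r x y s N (m⊔n≤o⇒n≤o (bound C) _ N≥)) }) ,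
    λ { (inj₁ a) → inj₁ (A⊆ a) ; (inj₂ b) → inj₂ (B⊆ b) }

  derivable-⊆ : ∀ {A B : ℕ → Set} → (∀ {f} → A f → B f) → Derivable B → Derivable A
  derivable-⊆ A⊆B (S , C , B⊆) = S , C , B⊆ ∘ A⊆B

  derivable-⋃ : ∀ {A : ℕ → ℕ → Set} n → (∀ i → i < n → Derivable (A i)) →
                Derivable (λ f → ∃[ i ] i < n × A i f)
  derivable-⋃ zero    D = (λ _ → ⊥) , closed-set {bound = 0} {0} (λ ()) (λ _ _ _ _ ()) , λ { (_ , () , _) }
  derivable-⋃ {A} (suc n) D = derivable-⊆ split
    (derivable-∪ (derivable-⋃ n (λ i i<n → D i (m<n⇒m<1+n i<n))) (D n ≤-refl))
    where
    split : ∀ {f} → (∃[ i ] i < suc n × A i f) → (∃[ i ] i < n × A i f) ⊎ A n f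
    split (i , i<1+n , a) with m<1+n⇒m<n∨m≡n i<1+n
    ... | inj₁ i<n  = inj₁ (i , i<n , a)
    ... | inj₂ refl = inj₂ a

  -- One inference: the conclusion is added to a closed set containing the premises A. The bound
  -- moves past the conclusion, so N exceeds every component of it.
  derive : ∀ {A} t r x y u → Derivable A →
           (∀ {N} → fact (pair t r) x y < N → (∀ {c x y} → A (fact c x y) → fact c x y < N) →
             Rule (λ c x y → A (fact c x y)) N g u t r x y) →
           Derivable (_≡ fact (pair t r) x y)
  derive {A} t r x y u (S , C , A⊆) rule = S′ ,
    closed-set {bound = B} {use C ⊔ u}
      (λ { (inj₁ s) → <-≤-trans (bounded C s) (m≤m⊔n _ _)
         ; (inj₂ refl) → m≤n⊔m (bound C) _ })
      (λ { t r x y (inj₁ s) N N≥ → Rule-mono inj₁ ≤-refl (m≤m⊔n _ _) t (closed C t r x y s N (m⊔n≤o⇒m≤o _ _ N≥))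
         ; t′ r′ x′ y′ (inj₂ eq) N N≥ → new t′ r′ eq N≥ }) ,
    inj₂
    where
    f = fact (pair t r) x y
    S′ : ℕ → Set
    S′ = λ f′ → S f′ ⊎ f′ ≡ f
    B = bound C ⊔ suc f
    new : ∀ t′ r′ {x′ y′ N} → fact (pair t′ r′) x′ y′ ≡ f → B ≤ N →
          Rule (λ c x y → S′ (fact c x y)) N g (use C ⊔ u) t′ r′ x′ y′
    new t′ r′ eq N≥ with fact-injective {c = pair t′ r′} eq
    ... | eq′ , refl , refl with pair-injective t′ r′ eq′
    ... | refl , refl = Rule-mono (inj₁ ∘ A⊆) ≤-refl (m≤n⊔m (use C) u) t
      (rule (m⊔n≤o⇒n≤o (bound C) _ N≥) (λ a → <-≤-trans (bounded C (A⊆ a)) (m⊔n≤o⇒m≤o _ _ N≥)))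

  axiom : ∀ t r x y u → (∀ {N} → fact (pair t r) x y < N → Rule (λ _ _ _ → ⊥) N g u t r x y) →
          Derivable (_≡ fact (pair t r) x y)
  axiom t r x y u rule = derive t r x y u (derivable-⋃ {λ _ _ → ⊥} 0 λ _ ())
    λ f< _ → Rule-mono {α = g} (λ ()) ≤-refl ≤-refl t (rule f<)

  complete-proj : ∀ {m} (i : Fin m) xs → Derivable (_≡ fact (pcode i) (vec xs) (lookup xs i))
  complete-proj 0F (x ∷ xs) = axiom 2 0 _ _ 0 λ f< → vec xs , pair<ʳ (arg< f<) , refl
  complete-proj (Fin.suc i) (x ∷ xs) = derive 3 (pcode i) _ _ 0 (complete-proj i xs) λ f< M< →
    x , pair<ˡ (arg< f<) , vec xs , pair<ʳ (arg< f<) , refl , refl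

  complete* : ∀ {m k} (ds : Vec (Rec ⊤ k) m) {xs : Vec ℕ k} {ys : Vec ℕ m} →
              (∀ i → Derivable (_≡ fact (code (lookup ds i)) (vec xs) (lookup ys i))) →
              Derivable (_≡ fact (code* ds) (vec xs) (vec ys))
  complete* []       {ys = []}         D = axiom 6 0 _ _ 0 λ _ → refl
  complete* (d ∷ ds) {xs} {y ∷ ys} D = derive 7 (pair (code d) (code* ds)) (vec xs) _ 0
    (derivable-∪ (D 0F) (complete* ds {xs} {ys} (D ∘ Fin.suc))) λ f< M< →
      code d , pair<ˡ (pair<ʳ (code< f<)) , code* ds , pair<ʳ (pair<ʳ (code< f<)) ,
      y , pair<ˡ (val< f<) , vec ys , pair<ʳ (val< f<) , refl , refl , inj₁ refl , inj₂ refl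

  -- The inferences of the derivation are replayed one by one. All witnesses for bounded quantifiers
  -- are components of facts in the set, hence below N.
  complete : ∀ {k} {e : Rec ⊤ k} {xs y} → (λ _ → g) ⊢ e · xs ⇓ y → Derivable (_≡ fact (code e) (vec xs) y)
  complete ⇓-zero = axiom 0 0 _ _ 0 λ _ → refl
  complete (⇓-suc {x}) = axiom 1 0 _ _ 0 λ f< → x , pair<ˡ (arg< f<) , refl , refl
  complete (⇓-proj {i = i} {xs}) = complete-proj i xs
  complete (⇓-oracle {x = x}) = axiom 4 0 _ _ (suc x) λ f< → x , pair<ˡ (arg< f<) , refl , ≤-refl , refl
  complete (⇓-comp {e = e} {ds} {xs} {ys} D E) =
    derive 5 _ _ _ 0 (derivable-∪ (complete* ds {xs} {ys} (λ i → complete (D i))) (complete E)) λ f< M< →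
      code e , pair<ˡ (pair<ʳ (code< f<)) , code* ds , pair<ʳ (pair<ʳ (code< f<)) ,
      vec ys , arg< (M< (inj₂ refl)) , refl , inj₁ refl , inj₂ refl
  complete (⇓-prec₀ {d = d} {e} {xs} D) = derive 8 _ _ _ 0 (complete D) λ f< M< →
    code d , pair<ˡ (pair<ʳ (code< f<)) , code e , pair<ʳ (pair<ʳ (code< f<)) ,
    0 , pair<ˡ (arg< f<) , vec xs , pair<ʳ (arg< f<) , refl , refl , (λ _ → refl) , λ _ _ ()
  complete (⇓-prec₊ {d = d} {e} {xs} {k} {y} D E) =
    derive 8 _ _ _ 0 (derivable-∪ (complete D) (complete E)) λ f< M< →
      code d , pair<ˡ (pair<ʳ (code< f<)) , code e , pair<ʳ (pair<ʳ (code< f<)) ,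
      suc k , pair<ˡ (arg< f<) , vec xs , pair<ʳ (arg< f<) , refl , refl , (λ ()) ,
      λ { _ _ refl → y , val< (M< (inj₁ refl)) , inj₁ refl , inj₂ refl }
  complete (⇓-mu {e = e} {xs} {y} D E) =
    derive 9 _ _ _ 0
      (derivable-∪ (complete E) (derivable-⋃ {A} y λ i i<y →
        -- The value at i is given as a function of the proof of i < y, so two such proofs have to
        -- be identified.
        derivable-⊆ (λ { (p , refl) → cong (nonzero i) (<-irrelevant p i<y) }) (complete (proj₂ (D i i<y))))) λ f< M< →
      inj₁ refl , λ i i<y → let a = inj₂ (i , i<y , i<y , refl) in
        proj₁ (D i i<y) , <-trans (n<1+n _) (val< (M< a)) , a
    where
    nonzero : ∀ i → i < y → ℕ
    nonzero i i<y = fact (code e) (pair i (vec xs)) (suc (proj₁ (D i i<y)))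
    A : ℕ → ℕ → Set
    A i f = Σ[ i<y ∈ i < y ] f ≡ nonzero i i<y

indicator : ExcludedMiddle 0ℓ → (ℕ → Set) → Cantor
indicator em S f with em {S f}
... | yes _ = 1F
... | no  _ = 0F

module _ (em : ExcludedMiddle 0ℓ) {S : ℕ → Set} where

  indicator-∈ : ∀ {f} → S f → toℕ (indicator em S f) ≡ 1
  indicator-∈ {f} s with em {S f}
  ... | yes _ = refl
  ... | no ¬s = contradiction s ¬s

  indicator-∉ : ∀ {f} → ¬ S f → toℕ (indicator em S f) ≡ 0
  indicator-∉ {f} ¬s with em {S f}
  ... | yes s = contradiction s ¬s
  ... | no _  = refl

  ∈-indicator : ∀ {f} → toℕ (indicator em S f) ≡ 1 → S f
  ∈-indicator {f} eq with em {S f}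
  ... | yes s = s
  ... | no _  = contradiction eq λ ()

-- The variables are L N τ n.
validF : Fm 4
validF = all (v 1) (all (v 2) (all (v 3) (all (v 4)
  (app inR (v 4 ∷ v 5 ∷ v 3 ∶ v 2 ∷ v 1 ∷ v 0 ∷ []) ⇒
   app ⟪ ruleF ⟫ (v 3 ∷ v 2 ∷ v 1 ∷ v 0 ∷ v 4 ∷ v 5 ∷ v 6 ∷ v 7 ∷ [])))))

-- L codes a set of facts below N that is closed under the rules, with oracle α below n.
Valid : ℕ → ℕ → (ℕ → ℕ) → ℕ → Set
Valid L N α n = ∀ t r x y → In L N (pair t r) x y → Rule (In L N) N α n t r x y

validF⇒Valid : ∀ {L N τ n} → (L ∷ N ∷ τ ∷ n ∷ []) ⊨ validF → Valid L N (bin τ) n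
validF⇒Valid h t r x y i@(_ , f<) =
  ruleF⇒Rule t (h t (pair<ˡ (code< f<)) r (pair<ʳ (code< f<)) x (arg< f<) y (val< f<) i)

Valid⇒validF : ∀ {L N τ n} → Valid L N (bin τ) n → (L ∷ N ∷ τ ∷ n ∷ []) ⊨ validF
Valid⇒validF h t _ r _ x _ y _ i = Rule⇒ruleF t (h t r x y i)

Rule-agree : ∀ {M N n} {α β : ℕ → ℕ} → (∀ a → a < n → α a ≡ β a) →
             ∀ t {r x y} → Rule M N α n t r x y → Rule M N β n t r x y
Rule-agree eq 0 h = h
Rule-agree eq 1 h = h
Rule-agree eq 2 h = h
Rule-agree eq 3 h = h
Rule-agree eq 4 (a , a< , p , a<n , q) = a , a< , p , a<n , trans q (eq a a<n)
Rule-agree eq 5 h = h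
Rule-agree eq 6 h = h
Rule-agree eq 7 h = h
Rule-agree eq 8 h = h
Rule-agree eq 9 h = h
Rule-agree eq (suc (suc (suc (suc (suc (suc (suc (suc (suc (suc t)))))))))) h = h

Valid-agree : ∀ {L N n} {α β : ℕ → ℕ} → (∀ a → a < n → α a ≡ β a) → Valid L N α n → Valid L N β n
Valid-agree eq V t r x y i = Rule-agree eq t (V t r x y i)

Valid-mono : ∀ {L N n m α} → n ≤ m → Valid L N α n → Valid L N α m
Valid-mono n≤m V t r x y i = Rule-mono id ≤-refl n≤m t (V t r x y i)

module _ (em : ExcludedMiddle 0ℓ) {g : ℕ → ℕ} where

  open Completeness g
  open Closed

  -- By excluded middle a bounded set of facts has a characteristic string, and L is its code.
  derivable⇒valid : ∀ {A} → Derivable A → ∃[ L ] ∃[ N ] ∃[ n ] Valid L N g n ×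
                    (∀ c x y → A (fact c x y) → In L N c x y)
  derivable⇒valid {A} (S , C , A⊆) = L , N , use C ,
    (λ t r x y i → Rule-mono S⊆ ≤-refl ≤-refl t (closed C t r x y (⊆S i) N ≤-refl)) ,
    λ c x y a → S⊆ (A⊆ a)
    where
    N : ℕ
    N = bound C
    L : ℕ
    L = ⌜ applyUpTo (indicator em S) N ⌝
    S⊆ : ∀ {c x y} → S (fact c x y) → In L N c x y
    S⊆ s = trans (bin-string (indicator em S) (bounded C s)) (indicator-∈ em {S} s) , bounded C s
    ⊆S : ∀ {c x y} → In L N c x y → S (fact c x y)
    ⊆S (eq , f<) = ∈-indicator em {S} (trans (sym (bin-string (indicator em S) f<)) eq)

  computation : ∀ {e : Rec ⊤ 1} {h : ℕ → ℕ} n → (∀ x → x < n → (λ _ → g) ⊢ e · Vec.[ x ] ⇓ h x) →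
                ∃[ L ] ∃[ N ] ∃[ u ] Valid L N g u ×
                (∀ x → x < n → In L N (code e) (pair x 0) (h x))
  computation {e} {h} n D with derivable⇒valid (derivable-⋃ {λ x → _≡ fact (code e) (pair x 0) (h x)} n
                                                λ x x<n → complete (D x x<n))
  ... | L , N , u , V , I = L , N , u , V , λ x x<n → I (code e) _ _ (x , x<n , refl)

value : ∀ {L N u α g} {e : Rec ⊤ 1} {x y z} → (∀ a → a < u → g a ≡ α a) → Valid L N α u →
        In L N (code e) (pair x 0) z → (λ _ → g) ⊢ e · Vec.[ x ] ⇓ y → z ≡ y
value {N = N} {e = e} agree V i D = Soundness.sound {N = N} agree V D i

-- Continuity: the finite set of facts behind the first n values stays valid for every oracle that
-- agrees below u, and by `value` it determines these values.
use : ExcludedMiddle 0ℓ → ∀ {g h} {e : Rec ⊤ 1} → e ⟨ g ⟩≃ h → ∀ n →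
      ∃[ u ] (∀ {g′ h′} → (∀ a → a < u → g′ a ≡ g a) → e ⟨ g′ ⟩≃ h′ → ∀ x → x < n → h x ≡ h′ x)
use em {e = e} D n with computation em {e = e} n (λ x _ → D x)
... | L , N , u , V , I = u , λ agree D′ x x<n → value {e = e} agree V (I x x<n) (D′ x)

-- The trees

infix 0 _represents_to_from_
_represents_to_from_ : ∀ {n} (φ : Fm n) (R : Vec ℕ n → Set) →
                     (∀ {xs} → xs ⊨ φ → R xs) → (∀ {xs} → R xs → xs ⊨ φ) → Rel n
φ represents R to toR from fromR = record
  { rel = R ; char = ⌊ χ φ ⌋ ; spec = λ xs → reflects-map toR fromR (reflects φ xs) }

-- The program with code tail j, run for K steps, outputs the bits of i in block j.
Outputs : ℕ → (ℕ → ℕ) → ℕ → ℕ → ℕ → Set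
Outputs j α n i K = ∃< K , λ N → ∃< K , λ L → Valid L N α n ×
  (∀ t → t < width (pos j) → In L N (tail j) (pair (pos j + t) 0) (bin i t))

-- γ forbids for each a < branch (pos k) one value of block k.
Misses : ℕ → (ℕ → ℕ) → (ℕ → ℕ) → Set
Misses k α γ = ∀ a → a < branch (pos k) → ∃< width (pos k) , λ t → α (pos k + t) ≢ γ (pair k (pair a t))

-- The string with code a is continued by some τ on which the program outputs i in
-- block j, no matter which values are forbidden in the blocks between j and K.
HitSpec : ℕ → ℕ → ℕ → ℕ → Set
HitSpec j a i K = j < K × (∀ γ → γ < branch (pair (pos K) (pair (pos K) (pos K))) → ∃< branch (pos K) , λ τ →
  (∀ x → x < pos j → bin τ x ≡ bin a x) × (∀ k → k < K → j < k → Misses k (bin τ) (bin γ)) ×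
  Outputs j (bin τ) (pos K) i K)

opaque

  Hit : ℕ → ℕ → ℕ → ℕ → Set
  Hit = HitSpec

  hit-intro : ∀ {j a i K} → HitSpec j a i K → Hit j a i K
  hit-intro = id

  hit-elim : ∀ {j a i K} → Hit j a i K → HitSpec j a i K
  hit-elim = id

-- Values i and stages K are tried in the order of t = `pair i K`. Since t bounds both, being the
-- first hit is a bounded notion.
HitAt : ℕ → ℕ → ℕ → Set
HitAt j a t = ∃< suc t , λ i → ∃< suc t , λ K → t ≡ pair i K × Hit j a i K

-- Block j must not have the value i that was found first for the index a.
Kill : ℕ → ℕ → ℕ → (ℕ → ℕ) → Set
Kill j a t α = ∃< suc t , λ i → ∃< suc t , λ K → t ≡ pair i K × Hit j a i K ×
  (∀ s → s < t → ¬ HitAt j a s) × (∀ x → x < width (pos j) → α (pos j + x) ≡ bin i x)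

-- Level j constrains the class b = bin j 0. Only levels whose block ends by n are
-- examined at stage n, so that all continuations of a string die together.
Admits : ℕ → ℕ → (ℕ → ℕ) → Set
Admits b n α = ∀ j → j < n → ∀ a → a < n → ∀ t → t < n → bin j 0 ≡ b → pos (suc j) < suc n →
  a < branch (pos j) → ¬ Kill j a t α

-- The tree on codes: `drop n c ≢ 0` expresses that n is below the length, and n < c follows from it
-- and bounds the quantifier.
tree-rel : Fin 2 → Vec ℕ 1 → Set
tree-rel b (c ∷ []) = ∀ n → n < c → drop n c ≢ 0 → Admits (toℕ b) n (bin c)

branch′ width′ pos′ tail′ : ∀ {n} → Tm n → Tm n
branch′ t = app branchᶠ (t ∷ [])
width′ t  = app widthᶠ (t ∷ [])
pos′ t    = app posᶠ (t ∷ [])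
tail′ t   = app tailᶠ (t ∷ [])

bin′ : ∀ {n} → Tm n → Tm n → Tm n
bin′ s t = app binᶠ (s ∷ t ∷ [])

validR : Rel 4
validR = validF represents (λ { (L ∷ N ∷ τ ∷ n ∷ []) → Valid L N (bin τ) n }) to
  (λ { {_ ∷ _ ∷ _ ∷ _ ∷ []} → validF⇒Valid }) from λ { {_ ∷ _ ∷ _ ∷ _ ∷ []} → Valid⇒validF }

outputsF : Fm 5
outputsF = ex (v 4) (ex (v 5) (app validR (v 0 ∷ v 1 ∷ v 3 ∷ v 4 ∷ []) ∧
  all (width′ (pos′ (v 2))) (app inR (v 1 ∷ v 2 ∷ tail′ (v 3) ∷ (pos′ (v 3) ∔ v 0) ∶ num 0 ∷ bin′ (v 6) (v 0) ∷ []))))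

outputsR : Rel 5
outputsR = outputsF represents (λ { (j ∷ τ ∷ n ∷ i ∷ K ∷ []) → Outputs j (bin τ) n i K }) to
  (λ { {_ ∷ _ ∷ _ ∷ _ ∷ _ ∷ []} → id }) from λ { {_ ∷ _ ∷ _ ∷ _ ∷ _ ∷ []} → id }

missesR : Rel 3
missesR = all (branch′ (pos′ (v 0))) (ex (width′ (pos′ (v 1)))
    (∼ (bin′ (v 3) (pos′ (v 2) ∔ v 0) ≐ bin′ (v 4) (v 2 ∶ (v 1 ∶ v 0)))))
  represents (λ { (k ∷ τ ∷ γ ∷ []) → Misses k (bin τ) (bin γ) }) to
  (λ { {_ ∷ _ ∷ _ ∷ []} → id }) from λ { {_ ∷ _ ∷ _ ∷ []} → id }

hitR : Rel 4
hitR = v 0 ≺ v 3 ∧ all (branch′ (pos′ (v 3) ∶ (pos′ (v 3) ∶ pos′ (v 3)))) (ex (branch′ (pos′ (v 4)))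
    (all (pos′ (v 2)) (bin′ (v 1) (v 0) ≐ bin′ (v 4) (v 0)) ∧
     all (v 5) (v 3 ≺ v 0 ⇒ app missesR (v 0 ∷ v 1 ∷ v 2 ∷ [])) ∧
     app outputsR (v 2 ∷ v 0 ∷ pos′ (v 5) ∷ v 4 ∷ v 5 ∷ [])))
  represents (λ { (j ∷ a ∷ i ∷ K ∷ []) → Hit j a i K }) to
  (λ { {_ ∷ _ ∷ _ ∷ _ ∷ []} → hit-intro }) from λ { {_ ∷ _ ∷ _ ∷ _ ∷ []} → hit-elim }

hitAtR : Rel 3
hitAtR = ex (1+ v 2) (ex (1+ v 3) (v 4 ≐ v 1 ∶ v 0 ∧ app hitR (v 2 ∷ v 3 ∷ v 1 ∷ v 0 ∷ [])))
  represents (λ { (j ∷ a ∷ t ∷ []) → HitAt j a t }) to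
  (λ { {_ ∷ _ ∷ _ ∷ []} → id }) from λ { {_ ∷ _ ∷ _ ∷ []} → id }

killR : Rel 4
killR = ex (1+ v 2) (ex (1+ v 3) (v 4 ≐ v 1 ∶ v 0 ∧ app hitR (v 2 ∷ v 3 ∷ v 1 ∷ v 0 ∷ []) ∧
    all (v 4) (∼ app hitAtR (v 3 ∷ v 4 ∷ v 0 ∷ [])) ∧
    all (width′ (pos′ (v 2))) (bin′ (v 6) (pos′ (v 3) ∔ v 0) ≐ bin′ (v 2) (v 0))))
  represents (λ { (j ∷ a ∷ t ∷ τ ∷ []) → Kill j a t (bin τ) }) to
  (λ { {_ ∷ _ ∷ _ ∷ _ ∷ []} → id }) from λ { {_ ∷ _ ∷ _ ∷ _ ∷ []} → id }

admitsR : Fin 2 → Rel 2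
admitsR b = all (v 0) (all (v 1) (all (v 2) (bin′ (v 2) (num 0) ≐ num (toℕ b) ⇒ pos′ (1+ v 2) ≺ 1+ v 3 ⇒
    v 1 ≺ branch′ (pos′ (v 2)) ⇒ ∼ app killR (v 2 ∷ v 1 ∷ v 0 ∷ v 4 ∷ []))))
  represents (λ { (n ∷ τ ∷ []) → Admits (toℕ b) n (bin τ) }) to
  (λ { {_ ∷ _ ∷ []} → id }) from λ { {_ ∷ _ ∷ []} → id }

treeR : Fin 2 → Rel 1
treeR b = all (v 0) (∼ (app dropᶠ (v 0 ∷ v 1 ∷ []) ≐ num 0) ⇒ app (admitsR b) (v 0 ∷ v 1 ∷ []))
  represents tree-rel b to (λ { {_ ∷ []} → id }) from λ { {_ ∷ []} → id }

-- Locality of the conditions, and the two classes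

Agree : ℕ → (ℕ → ℕ) → (ℕ → ℕ) → Set
Agree n α β = ∀ x → x < n → α x ≡ β x

agree-sym : ∀ {n α β} → Agree n α β → Agree n β α
agree-sym eq x x<n = sym (eq x x<n)

agree-trans : ∀ {n α β γ} → Agree n α β → Agree n β γ → Agree n α γ
agree-trans eq eq′ x x<n = trans (eq x x<n) (eq′ x x<n)

agree-≤ : ∀ {m n α β} → m ≤ n → Agree n α β → Agree m α β
agree-≤ m≤n eq x x<m = eq x (<-≤-trans x<m m≤n)

-- Hits do not refer to the sequence; only the last clause of `Kill` does, and it reads block j
-- alone.
Kill-block : ∀ {j a t} α β → Agree (width (pos j)) (α ∘ (pos j +_)) (β ∘ (pos j +_)) → Kill j a t α → Kill j a t β
Kill-block α β eq (i , i< , K , K< , p , h , first , block) =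
  i , i< , K , K< , p , h , first , λ x x< → trans (sym (eq x x<)) (block x x<)

agree-block : ∀ {j} α β → Agree (pos (suc j)) α β → Agree (width (pos j)) (α ∘ (pos j +_)) (β ∘ (pos j +_))
agree-block {j} α β eq x x< = eq _ (block<pos {j} x<)

Admits-agree : ∀ {b n α β} → Agree n α β → Admits b n α → Admits b n β
Admits-agree {α = α} {β} eq A j j< a a< t t< lev pos≤n a<b k =
  A j j< a a< t t< lev pos≤n a<b (Kill-block β α (agree-block {j} β α (agree-≤ (s≤s⁻¹ pos≤n) (agree-sym eq))) k)

bin-++ : ∀ σ τ → Agree (length σ) (bin ⌜ σ ⌝) (bin ⌜ σ ++ τ ⌝)
bin-++ (b ∷ σ) τ zero    _       = trans (bin-cons b ⌜ σ ⌝) (sym (bin-cons b ⌜ σ ++ τ ⌝))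
bin-++ (b ∷ σ) τ (suc x) (s≤s p) =
  trans (bin-cons-suc b ⌜ σ ⌝ x) (trans (bin-++ σ τ x p) (sym (bin-cons-suc b ⌜ σ ++ τ ⌝ x)))

Tree : Fin 2 → Pred String 0ℓ
Tree b σ = ∀ n → n < length σ → Admits (toℕ b) n (bin ⌜ σ ⌝)

isTree-Tree : ∀ b → IsTree (Tree b)
isTree-Tree b σ τ T n n<σ = Admits-agree (agree-≤ (<⇒≤ n<σ) (agree-sym (bin-++ σ τ)))
  (T n (<-≤-trans n<σ (≤-trans (m≤m+n _ (length τ)) (≤-reflexive (sym (length-++ σ))))))

tree-rel⇒Tree : ∀ b {σ} → tree-rel b (⌜ σ ⌝ ∷ []) → Tree b σ
tree-rel⇒Tree b {σ} h n n< = h n (<-≤-trans n< (length≤⌜⌝ σ)) (<length⇒drop σ n n<)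

Tree⇒tree-rel : ∀ b {σ} → Tree b σ → tree-rel b (⌜ σ ⌝ ∷ [])
Tree⇒tree-rel b {σ} T n _ d = T n (drop-string σ n d)

decide : ∀ {A B : Set} {e : Rec ⊥ 1} {x c} → (A → B) → (B → A) → Reflects01 A c → (λ ()) ⊢ e · Vec.[ x ] ⇓ c →
         (B × (λ ()) ⊢ e · Vec.[ x ] ⇓ 1) ⊎ (¬ B × (λ ()) ⊢ e · Vec.[ x ] ⇓ 0)
decide to from (inj₁ (a , refl))  D = inj₁ (to a , D)
decide to from (inj₂ (¬a , refl)) D = inj₂ (¬a ∘ from , D)

computable-Tree : ∀ b → Computable (Tree b)
computable-Tree b = prog (char (treeR b)) , λ σ →
  decide (tree-rel⇒Tree b {σ}) (Tree⇒tree-rel b {σ})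
    (spec (treeR b) (⌜ σ ⌝ ∷ [])) (correct (char (treeR b)) (⌜ σ ⌝ ∷ []))

Class : Fin 2 → Pred Cantor 0ℓ
Class b = Paths (Tree b)

index : ∀ b → Π⁰₁ (Class b)
index b = record
  { tree = Tree b ; isTree = isTree-Tree b ; computable = computable-Tree b ; paths = id , id }

seq : Cantor → ℕ → ℕ
seq f = toℕ ∘ f

-- What `Admits` demands of level j in the limit of all stages.
Safe : ℕ → (ℕ → ℕ) → Set
Safe j α = ∀ a t → a < branch (pos j) → ¬ Kill j a t α

Safe-block : ∀ {j} α β → Agree (width (pos j)) (α ∘ (pos j +_)) (β ∘ (pos j +_)) → Safe j α → Safe j β
Safe-block α β eq S a t a< k = S a t a< (Kill-block β α (agree-sym eq) k)

Safe-agree : ∀ {j α β} → Agree (pos (suc j)) α β → Safe j α → Safe j β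
Safe-agree {j} {α} {β} eq = Safe-block α β (agree-block {j} α β eq)

bin-applyUpTo : ∀ f n → Agree n (bin ⌜ applyUpTo f n ⌝) (seq f)
bin-applyUpTo f n x = bin-string f

Tree⇒Admits : ∀ b f {m n} → Tree b (applyUpTo f m) → n < m → Admits (toℕ b) n (seq f)
Tree⇒Admits b f {m} {n} T n<m = Admits-agree (agree-≤ (<⇒≤ n<m) (bin-applyUpTo f m))
  (T n (<-≤-trans n<m (≤-reflexive (sym (length-applyUpTo f m)))))

Admits⇒Tree : ∀ b f {m} → (∀ n → n < m → Admits (toℕ b) n (seq f)) → Tree b (applyUpTo f m)
Admits⇒Tree b f {m} A n n< =
  let n<m = <-≤-trans n< (≤-reflexive (length-applyUpTo f m)) in
  Admits-agree (agree-≤ (<⇒≤ n<m) (agree-sym (bin-applyUpTo f m))) (A n n<m)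

Class⇒Safe : ∀ {b f} → Class b f → ∀ {j} → bin j 0 ≡ toℕ b → Safe j (seq f)
Class⇒Safe {b} {f} P {j} lev a t a< = Tree⇒Admits b f {suc n} (P (suc n)) ≤-refl j
  (s≤s (m≤m+n j _)) a (s≤s (≤-trans (m≤m+n a _) (m≤n+m _ j)))
  t (s≤s (≤-trans (≤-trans (m≤m+n t _) (m≤n+m _ a)) (m≤n+m _ j))) lev
  (s≤s (≤-trans (m≤n+m (pos (suc j)) t) (≤-trans (m≤n+m _ a) (≤-trans (m≤n+m _ j) (n≤1+n _))))) a<
  where
  -- A stage beyond j, a, t and the end of block j, at which `Admits` examines this very kill.
  n = suc (j + (a + (t + pos (suc j))))

Safe⇒Class : ∀ {b f} → (∀ j → bin j 0 ≡ toℕ b → Safe j (seq f)) → Class b f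
Safe⇒Class {b} {f} S m = Admits⇒Tree b f {m} λ n _ j _ a _ t _ lev _ a< → S j lev a t a<

-- The diagonal argument

module Classical (em : ExcludedMiddle 0ℓ) where

  ¬¬-elim : ∀ {A : Set} → ¬ ¬ A → A
  ¬¬-elim = decidable-stable em

  ¬∀⇒∃¬ : ∀ {A : Set} {B : A → Set} → ¬ (∀ x → B x) → ∃[ x ] ¬ B x
  ¬∀⇒∃¬ h = ¬¬-elim λ ¬∃ → h λ x → ¬¬-elim λ ¬b → ¬∃ (x , ¬b)

  least : ∀ {P : ℕ → Set} n → P n → ∃[ m ] P m × (∀ k → k < m → ¬ P k)
  least {P} n = <-rec _ (λ n ih p → step n ih p em) n
    where
    step : ∀ n → (∀ {m} → m < n → P m → ∃[ m ] P m × (∀ k → k < m → ¬ P k)) → P n →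
           Dec (∃[ m ] m < n × P m) → ∃[ m ] P m × (∀ k → k < m → ¬ P k)
    step n ih p (yes (m , m<n , q)) = ih m<n q
    step n ih p (no ¬∃)             = n , p , λ k k<n q → ¬∃ (k , k<n , q)

  -- Compactness of Cantor space. If no bound were uniform, one could move from each node without a
  -- bound to a child without one, and the resulting path would contradict `bar`.
  module Fan (D : Cantor → ℕ → Set)
             (local : ∀ {f f′ n} → (∀ x → x < n → f x ≡ f′ x) → D f n → D f′ n)
             (bar : ∀ f → ∃[ n ] D f n) where

    Barred : Cantor → ℕ → Set
    Barred f n = ∃[ N ] (∀ f′ → (∀ x → x < n → f′ x ≡ f x) → ∃[ m ] m ≤ N × D f′ m)

    update : Cantor → ℕ → Fin 2 → Cantor
    update f n b x with x ≟ n
    ... | yes _ = b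
    ... | no _  = f x

    update-≡ : ∀ f n b → update f n b n ≡ b
    update-≡ f n b with n ≟ n
    ... | yes _  = refl
    ... | no n≢n = contradiction refl n≢n

    update-< : ∀ f {n} b {x} → x < n → update f n b x ≡ f x
    update-< f {n} b {x} x<n with x ≟ n
    ... | yes refl = contradiction x<n (<-irrefl refl)
    ... | no _     = refl

    extends-update : ∀ {f : Cantor} (f′ : Cantor) {n} b → f′ n ≡ b → (∀ x → x < n → f′ x ≡ f x) →
                     ∀ x → x < suc n → f′ x ≡ update f n b x
    extends-update {f} f′ {n} b eq eqs x x<1+n with m<1+n⇒m<n∨m≡n x<1+n
    ... | inj₁ x<n  = trans (eqs x x<n) (sym (update-< f b x<n))
    ... | inj₂ refl = trans eq (sym (update-≡ f n b))

    barred-node : ∀ {f n} → Barred (update f n 0F) (suc n) → Barred (update f n 1F) (suc n) → Barred f n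
    barred-node {f} {n} (N , h) (N′ , h′) = N ⊔ N′ , λ f′ eqs → split f′ eqs (f′ n) refl
      where
      split : ∀ f′ → (∀ x → x < n → f′ x ≡ f x) → ∀ b → f′ n ≡ b → ∃[ m ] m ≤ N ⊔ N′ × D f′ m
      split f′ eqs 0F eq with h f′ (extends-update f′ 0F eq eqs)
      ... | m , m≤ , d = m , ≤-trans m≤ (m≤m⊔n N N′) , d
      split f′ eqs 1F eq with h′ f′ (extends-update f′ 1F eq eqs)
      ... | m , m≤ , d = m , ≤-trans m≤ (m≤n⊔m N N′) , d

    choose : Cantor → ℕ → Fin 2
    choose f n with em {Barred (update f n 0F) (suc n)}
    ... | yes _ = 1F
    ... | no _  = 0F

    choose-unbarred : ∀ {f n} → ¬ Barred f n → ¬ Barred (update f n (choose f n)) (suc n)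
    choose-unbarred {f} {n} ¬b with em {Barred (update f n 0F) (suc n)}
    ... | yes b₀ = λ b₁ → ¬b (barred-node b₀ b₁)
    ... | no ¬b₀ = ¬b₀

    node : ℕ → Cantor
    node zero    = λ _ → 0F
    node (suc n) = update (node n) n (choose (node n) n)

    path : Cantor
    path x = node (suc x) x

    node-path : ∀ {n x} → x < n → node n x ≡ path x
    node-path {suc n} {x} x<1+n with m<1+n⇒m<n∨m≡n x<1+n
    ... | inj₁ x<n  = trans (update-< (node n) _ x<n) (node-path x<n)
    ... | inj₂ refl = refl

    fan : ∃[ N ] ∀ f → ∃[ m ] m ≤ N × D f m
    fan with em {Barred (node 0) 0}
    ... | yes (N , h) = N , λ f → h f λ _ ()
    ... | no ¬b       = contradiction barred-path (unbarred (proj₁ (bar path)))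
      where
      unbarred : ∀ n → ¬ Barred (node n) n
      unbarred zero    = ¬b
      unbarred (suc n) = choose-unbarred (unbarred n)
      n = proj₁ (bar path)
      barred-path : Barred (node n) n
      -- By locality the n at which the path satisfies D serves all sequences through its node at
      -- height n.
      barred-path = n , λ f′ eqs → n , ≤-refl ,
        local (λ x x<n → sym (trans (eqs x x<n) (node-path x<n))) (proj₂ (bar path))

  flip : ℕ → Fin 2
  flip zero    = 1F
  flip (suc _) = 0F

  flip-≢ : ∀ y → toℕ (flip y) ≢ y
  flip-≢ zero    ()
  flip-≢ (suc y) ()

  -- Bit pair i a of block k is used to differ from the a-th value forbidden by γ i.
  module Construct (f₀ : Cantor) (J : ℕ) (γ : ℕ → ℕ → ℕ) where

    Position : ℕ → Set
    Position x = ∃[ k ] ∃[ i ] ∃[ a ] J ≤ k × i ≤ branch (pos k) × a ≤ branch (pos k) × x ≡ pos k + pair i a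

    from-dec : ∀ x → Dec (Position x) → Fin 2
    from-dec x (yes (k , i , a , _)) = flip (γ i (pair k (pair a (pair i a))))
    from-dec x (no _)                = f₀ x

    f : Cantor
    f x = from-dec x em

    f-below : ∀ x → x < pos J → f x ≡ f₀ x
    f-below x x<J = lem em
      where
      lem : ∀ d → from-dec x d ≡ f₀ x
      lem (yes (k , i , a , J≤k , _ , _ , refl)) =
        contradiction (≤-<-trans (pos-mono J≤k) (≤-<-trans (m≤m+n _ _) x<J)) (<-irrefl refl)
      lem (no _) = refl

    -- A position determines k, i and a, so whichever witnesses excluded middle has supplied in `f`,
    -- they are the intended ones.
    f-misses : ∀ k i → J ≤ k → i ≤ branch (pos k) → Misses k (seq f) (γ i)
    f-misses k i J≤k i≤ a a< = pair i a , pair<width i≤ (<⇒≤ a<) , lem em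
      where
      lem : ∀ d → toℕ (from-dec (pos k + pair i a) d) ≢ γ i (pair k (pair a (pair i a)))
      lem (no ¬p) = contradiction (k , i , a , J≤k , i≤ , <⇒≤ a< , refl) ¬p
      lem (yes (k′ , i′ , a′ , _ , i′≤ , a′≤ , eq))
        with block-injective {k} {k′} (pair<width i≤ (<⇒≤ a<)) (pair<width i′≤ a′≤) eq
      ... | refl , eq′ with pair-injective i a eq′
      ... | refl , refl = flip-≢ _

  -- i is the value forbidden in block k on behalf of the string with code a, namely the one hit
  -- first.
  Color : ℕ → ℕ → ℕ → Set
  Color k a i = ∃[ K ] Hit k a i K × (∀ s → s < pair i K → ¬ HitAt k a s)

  hitAt : ∀ {k a i K} → Hit k a i K → HitAt k a (pair i K)
  hitAt h = _ , s≤s (≤-pairˡ _ _) , _ , s≤s (≤-pairʳ _ _) , refl , h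

  color-unique : ∀ {k a i i′} → Color k a i → Color k a i′ → i ≡ i′
  color-unique {i = i} {i′} (K , h , first) (K′ , h′ , first′) with <-cmp (pair i K) (pair i′ K′)
  ... | tri< lt _ _ = contradiction (hitAt h) (first′ _ lt)
  ... | tri> _ _ gt = contradiction (hitAt h′) (first _ gt)
  ... | tri≈ _ eq _ = proj₁ (pair-injective i K eq)

  ForbiddenBit : ℕ → Set
  ForbiddenBit z = ∃[ k ] ∃[ a ] ∃[ t ] ∃[ i ] z ≡ pair k (pair a t) × Color k a i × bin i t ≡ 1

  -- All forbidden values in the layout that `Misses` reads. Where no value is forbidden the bits
  -- are 0, and avoiding zeros there does no harm.
  forbidden : Cantor
  forbidden = indicator em ForbiddenBit

  forbidden-color : ∀ {k a i} t → Color k a i → seq forbidden (pair k (pair a t)) ≡ bin i t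
  forbidden-color {k} {a} {i} t c = lem em
    where
    z = pair k (pair a t)
    lem : Dec (ForbiddenBit z) → seq forbidden z ≡ bin i t
    lem (yes p@(k′ , a′ , t′ , i′ , eq , c′ , one)) with pair-injective k (pair a t) eq
    ... | refl , eq′ with pair-injective a t eq′
    ... | refl , refl with color-unique c c′
    ... | refl = trans (indicator-∈ em {ForbiddenBit} p) (sym one)
    lem (no ¬p) with bin i t in eq | bin≤1 i t
    ... | 0 | _ = indicator-∉ em {ForbiddenBit} ¬p
    ... | suc (suc _) | s≤s ()
    ... | 1 | _ = contradiction (k , a , t , i , refl , c , eq) ¬p

  misses⇒safe : ∀ {k} α → Misses k α (seq forbidden) → Safe k α
  misses⇒safe {k} α m a t a< (i , _ , K , _ , refl , h , first , block) with m a a<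
  ... | x , x< , ≢ = ≢ (trans (block x x<) (sym (forbidden-color x (K , h , first))))

  Misses-agree : ∀ {k n m α β γ δ} → Agree n α β → pos (suc k) ≤ n →
                 Agree m γ δ → pair k (pair (pos (suc k)) (pos (suc k))) ≤ m → Misses k α γ → Misses k β δ
  Misses-agree {k} αβ ≤n γδ ≤m miss a a< with miss a a<
  ... | t , t< , ≢ = t , t< , λ eq → ≢ (trans (αβ _ (<-≤-trans (block<pos {k} t<) ≤n)) (trans eq
    (sym (γδ _ (<-≤-trans (pair-sum-< {k} {pair a t} (+-monoʳ-< k (pair-sum-< {a} {t} (+-mono-<
      (<-≤-trans (<-trans a< (branch<width (pos k))) (width≤pos k)) (<-≤-trans t< (width≤pos k)))))) ≤m)))))

  bit : ℕ → Fin 2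
  bit zero    = 0F
  bit (suc _) = 1F

  toℕ-bit : ∀ d x → toℕ (bit (bin d x)) ≡ bin d x
  toℕ-bit d x with bin d x | bin≤1 d x
  ... | 0           | _ = refl
  ... | 1           | _ = refl
  ... | suc (suc _) | s≤s ()

  Outputs-agree : ∀ {j n m i K K′ α β} → n ≤ m → K ≤ K′ → Agree n α β → Outputs j α n i K → Outputs j β m i K′
  Outputs-agree n≤m K≤K′ αβ (N , N< , L , L< , V , out) = N , <-≤-trans N< K≤K′ , L , <-≤-trans L< K≤K′ ,
    Valid-mono n≤m (Valid-agree αβ V) , out

  SafeExcept : ℕ → Cantor → Set
  SafeExcept j f = ∀ k → k ≢ j → Safe k (seq f)

  -- A common element of both classes. It supplies the prefix for the diagonal argument and the
  -- point at which a reduction of P ⊕ Q to P ∪ Q is evaluated first.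
  everywhere-safe : ∃[ f ] ∀ k → Safe k (seq f)
  everywhere-safe = f , λ k → misses⇒safe (seq f) (f-misses k 0 z≤n z≤n)
    where open Construct (λ _ → 0F) 0 (λ _ → seq forbidden)

  -- The block number j has b as its bit 0 and the program as its tail. So members of `Class b` are
  -- safe in block j, and an output forbidden there is contradictory.
  module Diagonal (e : Rec ⊤ 1) (b : Fin 2)
                  (total : ∀ f → SafeExcept (cons b (code e)) f → ∃[ u ] (e ⟨ seq f ⟩≃ seq u) × Class b u) where

    j : ℕ
    j = cons b (code e)

    f₀ : Cantor
    f₀ = proj₁ everywhere-safe

    -- One string of length `pos j` is enough for the contradiction; this one is safe in all blocks
    -- below j.
    prefix : ℕ
    prefix = ⌜ applyUpTo f₀ (pos j) ⌝

    -- Bits of forbidden values in blocks below K have triples of numbers up to `pos K` as indices,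
    -- so a string of this length records all of them.
    range : ℕ → ℕ
    range K = pair (pos K) (pair (pos K) (pos K))

    k≤range : ∀ {k K} → k < K → pair k (pair (pos (suc k)) (pos (suc k))) ≤ range K
    k≤range {k} {K} k<K = pair-mono (≤-trans (<⇒≤ k<K) (n≤pos K)) (pair-mono (pos-mono k<K) (pos-mono k<K))

    -- If a hit occurs, the set of forbidden values itself is one of the γ quantified over.
    no-hit : ∀ t → ¬ HitAt j prefix t
    no-hit t₀ h₀ with least {HitAt j prefix} t₀ h₀
    ... | t , (i , i< , K , K< , refl , hit) , first with hit-elim hit
    ... | j<K , h with h ⌜ applyUpTo forbidden (range K) ⌝ (string<branch forbidden ≤-refl)
    ... | τ , _ , pre , miss , N , _ , L , _ , V , out =
      Class⇒Safe {b} {u} (proj₂ (proj₂ out-u)) (bin-cons b (code e)) prefix (pair i K) (string<branch f₀ ≤-refl)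
        (i , i< , K , K< , refl , hit , first , λ x x< →
          sym (value {e = e} (λ a a< → f≈τ a a<) V
            (subst (λ c → In L N c (pair (pos j + x) 0) (bin i x)) (tail-cons b (code e)) (out x x<))
            (proj₁ (proj₂ out-u) (pos j + x))))
      where
      -- Up to `pos K` the sequence is τ, which fixes the output i; from block K on it avoids the
      -- forbidden values.
      open Construct (bit ∘ bin τ) K (λ _ → seq forbidden)
      f≈τ : Agree (pos K) (seq f) (bin τ)
      f≈τ x x< = trans (cong toℕ (f-below x x<)) (toℕ-bit τ x)
      safe : SafeExcept j f
      safe k k≢j with <-cmp k j
      ... | tri≈ _ k≡j _ = contradiction k≡j k≢j
      ... | tri< k<j _ _ = Safe-agree {k} {seq f₀} {seq f} (λ x x< →
        let x<j = <-≤-trans x< (pos-mono k<j) in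
        trans (sym (bin-applyUpTo f₀ (pos j) x x<j)) (trans (sym (pre x x<j))
          (sym (f≈τ x (<-≤-trans x<j (pos-mono (<⇒≤ j<K)))))))
        (proj₂ everywhere-safe k)
      ... | tri> _ _ j<k with k <? K
      ... | yes k<K = misses⇒safe (seq f) (Misses-agree (agree-sym f≈τ) (pos-mono k<K)
                        (bin-applyUpTo forbidden (range K)) (k≤range k<K) (miss k k<K j<k))
      ... | no k≮K  = misses⇒safe (seq f) (f-misses k 0 (≮⇒≥ k≮K) z≤n)
      out-u : ∃[ u ] (e ⟨ seq f ⟩≃ seq u) × Class b u
      out-u = total f safe
      u : Cantor
      u = proj₁ out-u

    -- Without hits there are, by compactness, a stage K by which the computations on all
    -- admissible f have converged and for each i a γ that escapes a hit on i at K;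
    -- an f missing all of these γ is contradictory.
    Decided : Cantor → ℕ → Set
    Decided f n = (∃[ k ] k ≢ j × pos (suc k) ≤ n × ¬ Safe k (seq f)) ⊎
                  (∃[ i ] i < branch (pos (suc j)) × Outputs j (seq f) n i n)

    decided-local : ∀ {f f′ n} → (∀ x → x < n → f x ≡ f′ x) → Decided f n → Decided f′ n
    decided-local eq (inj₁ (k , k≢j , ≤n , ¬s)) =
      inj₁ (k , k≢j , ≤n , λ s → ¬s (Safe-agree (λ x x< → sym (cong toℕ (eq x (<-≤-trans x< ≤n)))) s))
    decided-local eq (inj₂ (i , i< , o)) =
      inj₂ (i , i< , Outputs-agree ≤-refl ≤-refl (λ x x< → cong toℕ (eq x x<)) o)

    -- A failure of safety in another block shows on a finite part of f. Otherwise totality gives a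
    -- computation, and n exceeds the codes and the use of its facts.
    decided : ∀ f → ∃[ n ] Decided f n
    decided f with em {∃[ k ] k ≢ j × ¬ Safe k (seq f)}
    ... | yes (k , k≢j , ¬s) = pos (suc k) , inj₁ (k , k≢j , ≤-refl , ¬s)
    ... | no ¬∃ with total f (λ k k≢j → ¬¬-elim λ ¬s → ¬∃ (k , k≢j , ¬s))
    ... | u , D , _ with computation em {e = e} {seq u} (pos (suc j)) (λ x _ → D x)
    ... | L , N , use , V , I = n , inj₂ (i , string<branch block (width≤pos j) ,
        N , s≤s (≤-trans (m≤m+n N _) (m≤n+m _ L)) , L , s≤s (m≤m+n L _) ,
        Valid-mono (≤-trans (≤-trans (m≤n+m use N) (m≤n+m _ L)) (n≤1+n _)) V ,
        λ t t< → subst₂ (λ c y → In L N c (pair (pos j + t) 0) y) (sym (tail-cons b (code e)))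
          (sym (bin-string block t<)) (I (pos j + t) (block<pos {j} t<)))
      where
      n = suc (L + (N + use))
      block : Cantor
      block t = u (pos j + t)
      i = ⌜ applyUpTo block (width (pos j)) ⌝

    K : ℕ
    K = proj₁ (Fan.fan Decided decided-local decided) + suc j

    j<K : j < K
    j<K = m≤n+m _ _

    Escapes : ℕ → ℕ → Set
    Escapes i γ = ¬ (γ < branch (range K) → ∃< branch (pos K) , λ τ →
      (∀ x → x < pos j → bin τ x ≡ bin prefix x) × (∀ k → k < K → j < k → Misses k (bin τ) (bin γ)) ×
      Outputs j (bin τ) (pos K) i K)

    escape : ∀ i → ∃[ γ ] Escapes i γ
    escape i = ¬∀⇒∃¬ λ h → no-hit (pair i K) (hitAt (hit-intro (j<K , h)))

    -- Collection 0 keeps f safe, collection i + 1 defeats the value i. The values that fit block j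
    -- are below `branch (pos (suc j))`, so every later block has room for all of them.
    γ : ℕ → ℕ → ℕ
    γ zero    = seq forbidden
    γ (suc i) = bin (proj₁ (escape i))

    open Construct f₀ (suc j) γ

    f-safe : SafeExcept j f
    f-safe k k≢j with <-cmp k j
    ... | tri≈ _ k≡j _ = contradiction k≡j k≢j
    ... | tri> _ _ j<k = misses⇒safe (seq f) (f-misses k 0 j<k z≤n)
    ... | tri< k<j _ _ = Safe-agree {k} {seq f₀} {seq f}
      (λ x x< → sym (cong toℕ (f-below x (<-≤-trans x< (pos-mono (s≤s (<⇒≤ k<j)))))))
      (proj₂ everywhere-safe k)

    absurd : ⊥
    absurd with proj₂ (Fan.fan Decided decided-local decided) f
    ... | n , n≤ , inj₁ (k , k≢j , _ , ¬s) = ¬s (f-safe k k≢j)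
    -- f outputs i by stage K although it misses `γ (suc i)`, so its prefix τ is a continuation of
    -- the kind that `escape i` rules out.
    ... | n , n≤ , inj₂ (i , i< , o) = proj₂ (escape i) λ γ< →
      τ , string<branch f ≤-refl , (λ x x< → trans (τ≈f x (<-≤-trans x< (pos-mono (<⇒≤ j<K))))
        (trans (cong toℕ (f-below x (<-≤-trans x< (pos-≤-suc j)))) (sym (bin-applyUpTo f₀ (pos j) x x<)))) ,
      (λ k k<K j<k → Misses-agree {γ = γ (suc i)} (agree-sym τ≈f) (pos-mono k<K) (λ _ _ → refl) (k≤range k<K)
        (f-misses k (suc i) j<k (≤-trans i< (branch-mono (pos-mono j<k))))) ,
      Outputs-agree n≤pos-K n≤K (agree-≤ n≤pos-K (agree-sym τ≈f)) o
      where
      τ : ℕ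
      τ = ⌜ applyUpTo f (pos K) ⌝
      τ≈f : Agree (pos K) (bin τ) (seq f)
      τ≈f = bin-applyUpTo f (pos K)
      n≤K : n ≤ K
      n≤K = ≤-trans n≤ (m≤m+n _ _)
      n≤pos-K : n ≤ pos K
      n≤pos-K = ≤-trans n≤K (n≤pos K)

  diagonal : ∀ e b → ¬ (∀ f → SafeExcept (cons b (code e)) f → ∃[ u ] (e ⟨ seq f ⟩≃ seq u) × Class b u)
  diagonal e b total = Diagonal.absurd e b total

-- Reductions

infix 9 _[_] _[_]*
_[_]  : ∀ {n} → Rec ⊤ n → Rec ⊤ 1 → Rec ⊤ n
_[_]* : ∀ {n m} → Vec (Rec ⊤ n) m → Rec ⊤ 1 → Vec (Rec ⊤ n) m

zero [ d ]      = zero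
suc [ d ]       = suc
proj i [ d ]    = proj i
oracle _ [ d ]  = d
comp e es [ d ] = comp (e [ d ]) (es [ d ]*)
prec e e′ [ d ] = prec (e [ d ]) (e′ [ d ])
mu e [ d ]      = mu (e [ d ])

[] [ d ]*       = []
(e ∷ es) [ d ]* = e [ d ] ∷ es [ d ]*

lookup-[] : ∀ {n m} (es : Vec (Rec ⊤ n) m) d i → lookup (es [ d ]*) i ≡ lookup es i [ d ]
lookup-[] (e ∷ es) d Fin.zero    = refl
lookup-[] (e ∷ es) d (Fin.suc i) = lookup-[] es d i

⇓-[] : ∀ {g h d} → d ⟨ g ⟩≃ h → ∀ {n} {e : Rec ⊤ n} {xs y} →
       (λ _ → h) ⊢ e · xs ⇓ y → (λ _ → g) ⊢ e [ d ] · xs ⇓ y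
⇓-[] D ⇓-zero         = ⇓-zero
⇓-[] D ⇓-suc          = ⇓-suc
⇓-[] D ⇓-proj         = ⇓-proj
⇓-[] D (⇓-oracle)     = D _
⇓-[] {g} {d = d} D (⇓-comp {ds = es} {xs} {ys} Es E) =
  ⇓-comp (λ i → subst (λ e → (λ _ → g) ⊢ e · xs ⇓ lookup ys i) (sym (lookup-[] es d i)) (⇓-[] D (Es i))) (⇓-[] D E)
⇓-[] D (⇓-prec₀ E)    = ⇓-prec₀ (⇓-[] D E)
⇓-[] D (⇓-prec₊ E E′) = ⇓-prec₊ (⇓-[] D E) (⇓-[] D E′)
⇓-[] D (⇓-mu Es E)    = ⇓-mu (λ i i<y → proj₁ (Es i i<y) , ⇓-[] D (proj₂ (Es i i<y))) (⇓-[] D E)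

-- With n the length of ρ this replaces an initial segment of the oracle; with n = 0 it puts ρ in
-- front.
splice : String → ℕ → Rec ⊤ 1
splice []      n = comp (oracle tt) (compile (num n ∔ v 0) ∷ [])
splice (b ∷ ρ) n = prec (constant (toℕ b)) (comp (splice ρ n) (proj 0F ∷ []))

⇓-splice : ∀ ρ n f → splice ρ n ⟨ seq f ⟩≃ seq (ρ ⌢ (f ∘ (n +_)))
⇓-splice []      n f x = ⇓-comp {ys = n + x ∷ []} (λ { 0F → ⇓-compile (num n ∔ v 0) (x ∷ []) }) ⇓-oracle
⇓-splice (b ∷ ρ) n f zero    = ⇓-prec₀ (⇓-constant (toℕ b))
⇓-splice (b ∷ ρ) n f (suc x) = ⇓-prec₊ (⇓-splice (b ∷ ρ) n f x)
  (⇓-comp {ys = x ∷ []} (λ { 0F → ⇓-proj }) (⇓-splice ρ n f x))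

⌢-< : ∀ h n f {x} → x < n → (applyUpTo h n ⌢ f) x ≡ h x
⌢-< h (suc n) f {zero}  _       = refl
⌢-< h (suc n) f {suc x} (s≤s p) = ⌢-< (h ∘ suc) n f p

⌢-+ : ∀ h n f x → (applyUpTo h n ⌢ f) (n + x) ≡ f x
⌢-+ h zero    f x = refl
⌢-+ h (suc n) f x = ⌢-+ (h ∘ suc) n f x

applyUpTo-cong : ∀ {f h : Cantor} n → (∀ x → x < n → f x ≡ h x) → applyUpTo f n ≡ applyUpTo h n
applyUpTo-cong zero    eq = refl
applyUpTo-cong (suc n) eq = cong₂ _∷_ (eq 0 (s≤s z≤n)) (applyUpTo-cong n λ x x<n → eq (suc x) (s≤s x<n))

Class-resp : ∀ {b f h} → f ≗ h → Class b f → Class b h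
Class-resp {b} eq P n = subst (Tree b) (applyUpTo-cong n λ x _ → eq x) (P n)

⌢-≥ : ∀ h n f {x} → n ≤ x → (applyUpTo h n ⌢ (f ∘ (n +_))) x ≡ f x
⌢-≥ h n f {x} n≤x =
  subst (λ y → (applyUpTo h n ⌢ (f ∘ (n +_))) y ≡ f y) (m+[n∸m]≡n n≤x) (⌢-+ h n (f ∘ (n +_)) (x ∸ n))

-- The seam is a block boundary, so each block comes entirely from h or entirely from f.
Safe-⌢ : ∀ {k} U f h → Safe k (seq h) → Safe k (seq f) → Safe k (seq (applyUpTo h (pos U) ⌢ (f ∘ (pos U +_))))
Safe-⌢ {k} U f h Sh Sf with k <? U
... | yes k<U = Safe-agree {k} {seq h}
  (λ x x< → sym (cong toℕ (⌢-< h (pos U) (f ∘ (pos U +_)) (<-≤-trans x< (pos-mono k<U))))) Sh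
... | no k≮U  = Safe-block {k} (seq f) (seq (applyUpTo h (pos U) ⌢ (f ∘ (pos U +_))))
  (λ x _ → sym (cong toℕ (⌢-≥ h (pos U) f (≤-trans (pos-mono (≮⇒≥ k≮U)) (m≤m+n _ x))))) Sf

other : Fin 2 → Fin 2
other 0F = 1F
other 1F = 0F

level-≢ : ∀ b {k} c → bin k 0 ≡ toℕ (other b) → k ≢ cons b c
level-≢ 0F c eq refl = contradiction (trans (sym (bin-cons 0F c)) eq) λ ()
level-≢ 1F c eq refl = contradiction (trans (sym (bin-cons 1F c)) eq) λ ()

P Q : Pred Cantor 0ℓ
P = Class 0F
Q = Class 1F

inject : ∀ b {f} → Class b f → (P ∪ Q) f
inject 0F = inj₁
inject 1F = inj₂

⊕-first : ∀ {u} → (P ⊕ Q) u → Class (u 0) (u ∘ suc)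
⊕-first {u} (inj₁ (p , Pp , eq)) rewrite eq 0 = Class-resp (sym ∘ eq ∘ suc) Pp
⊕-first {u} (inj₂ (q , Qq , eq)) rewrite eq 0 = Class-resp (sym ∘ eq ∘ suc) Qq

reduces : ∀ {A B : Pred Cantor 0ℓ} (r : ↑ A ≤¹₁ ↑ B) → ∀ f → B f → ∃[ u ] (proj₁ r ⟨ seq f ⟩≃ seq u) × A u
reduces (e , R) f Bf with R (seq f) (f , Bf , λ _ → refl)
... | h , D , u , Au , eq = u , (λ n → ⇓-resp (eq n) (D n)) , Au

P∪Q≤P⊕Q : ↑ (P ∪ Q) ≤¹₁ ↑ (P ⊕ Q)
P∪Q≤P⊕Q = comp (oracle tt) (suc ∷ []) , λ g (f , PQ , eq) →
  g ∘ suc , (λ n → ⇓-comp {ys = _ ∷ []} (λ { 0F → ⇓-suc }) ⇓-oracle) , f ∘ suc , inject (f 0) (⊕-first PQ) , eq ∘ suc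

module _ (em : ExcludedMiddle 0ℓ) where

  open Classical em

  safe⇒class : ∀ b c {f} → SafeExcept (cons b c) f → Class (other b) f
  safe⇒class b c S = Safe⇒Class λ k lev → S k (level-≢ b c lev)

  P⊕Q≰P∪Q : ¬ (↑ (P ⊕ Q) ≤¹₁ ↑ (P ∪ Q))
  -- Inputs receive the initial segment ρ of f₀, which forces the first output bit to be b; what
  -- follows that bit is then in `Class b`.
  P⊕Q≰P∪Q r@(e , _) = diagonal (comp (e [ d ]) (suc ∷ [])) b total
    where
    f₀ : Cantor
    f₀ = proj₁ everywhere-safe
    r₀ : ∃[ u ] (e ⟨ seq f₀ ⟩≃ seq u) × (P ⊕ Q) u
    r₀ = reduces r f₀ (inj₁ (Safe⇒Class λ k _ → proj₂ everywhere-safe k))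
    b : Fin 2
    b = proj₁ r₀ 0
    use₁ : _
    use₁ = use em {e = e} (proj₁ (proj₂ r₀)) 1
    U : ℕ
    U = proj₁ use₁
    -- The use U is raised to the block boundary `pos U`, as `Safe-⌢` demands.
    ρ : String
    ρ = applyUpTo f₀ (pos U)
    d : Rec ⊤ 1
    d = splice ρ (pos U)
    total : ∀ f → SafeExcept (cons b (code (comp (e [ d ]) (suc ∷ [])))) f →
            ∃[ u ] (comp (e [ d ]) (suc ∷ []) ⟨ seq f ⟩≃ seq u) × Class b u
    total f S = u ∘ suc ,
      (λ n → ⇓-comp {ys = _ ∷ []} (λ { 0F → ⇓-suc }) (⇓-[] (⇓-splice ρ (pos U) f) (D (suc n)))) ,
      subst (λ c → Class c (u ∘ suc)) (sym first) (⊕-first PQu)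
      where
      f′ : Cantor
      f′ = ρ ⌢ (f ∘ (pos U +_))
      r₁ : ∃[ u ] (e ⟨ seq f′ ⟩≃ seq u) × (P ⊕ Q) u
      r₁ = reduces r f′ (inject (other b) (Safe⇒Class λ k lev →
        Safe-⌢ U f f₀ (proj₂ everywhere-safe k) (S k (level-≢ b (code (comp (e [ d ]) (suc ∷ []))) lev))))
      u : Cantor
      u = proj₁ r₁
      D : e ⟨ seq f′ ⟩≃ seq u
      D = proj₁ (proj₂ r₁)
      PQu : (P ⊕ Q) u
      PQu = proj₂ (proj₂ r₁)
      first : b ≡ u 0
      first = toℕ-injective (proj₂ use₁ {h′ = seq u} (λ x x<U →
        cong toℕ (⌢-< f₀ (pos U) (f ∘ (pos U +_)) (<-≤-trans x<U (n≤pos U)))) D 0 (s≤s z≤n))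

-- Leaves of the trees, and the irreducibility of P ∪ Q to P ⌢ Q

Tree-∷ʳ : ∀ b f {m} → Tree b (applyUpTo f m) → Admits (toℕ b) m (seq f) → Tree b (applyUpTo f (suc m))
Tree-∷ʳ b f {m} T A = Admits⇒Tree b f {suc m} λ n n<1+m → lem n (m<1+n⇒m<n∨m≡n n<1+m)
  where
  lem : ∀ n → n < m ⊎ n ≡ m → Admits (toℕ b) n (seq f)
  lem n (inj₁ n<m)  = Tree⇒Admits b f {m} T n<m
  lem n (inj₂ refl) = A

-- Whether a string of length m + 1 is in the tree does not depend on its last bit.
leaf : ∀ b f m → Tree b (applyUpTo f m) → ¬ Tree b (applyUpTo f (suc m)) → Leaf (Tree b) (applyUpTo f m)
leaf b f m T ¬T = T , only
  where
  only : ∀ τ → Tree b (applyUpTo f m ++ τ) → τ ≡ []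
  only []      _  = refl
  only (c ∷ τ) T′ = contradiction (Tree-∷ʳ b f T (Admits-agree
      (agree-trans (agree-sym (subst (λ l → Agree l (bin ⌜ applyUpTo f m ⌝) (bin ⌜ applyUpTo f m ++ c ∷ τ ⌝))
        (length-applyUpTo f m) (bin-++ (applyUpTo f m) (c ∷ τ)))) (bin-applyUpTo f m))
      (T′ m m<))) ¬T
    where
    m< : m < length (applyUpTo f m ++ c ∷ τ)
    m< = <-≤-trans (m<m+n m (s≤s z≤n)) (≤-reflexive (sym (trans (length-++ (applyUpTo f m))
           (cong (_+ suc (length τ)) (length-applyUpTo f m)))))

Tree-≤ : ∀ b f {m n} → m ≤ n → Tree b (applyUpTo f n) → Tree b (applyUpTo f m)
Tree-≤ b f {m} {n} m≤n T = Admits⇒Tree b f {m} λ k k<m → Tree⇒Admits b f {n} T (<-≤-trans k<m m≤n)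

module _ (em : ExcludedMiddle 0ℓ) where

  open Classical em

  exit : ∀ {b f} → ¬ Class b f → ∃[ m ] Tree b (applyUpTo f m) × ¬ Tree b (applyUpTo f (suc m))
  exit {b} {f} ¬P with ¬∀⇒∃¬ ¬P
  ... | n , ¬T with least {λ n → ¬ Tree b (applyUpTo f n)} n ¬T
  ... | zero  , ¬T₀ , _     = contradiction (λ _ ()) ¬T₀
  ... | suc m , ¬Tₘ , first = m , ¬¬-elim (first m ≤-refl) , ¬Tₘ

  -- Otherwise the program would map P into Q, against `diagonal`: the sequences that are safe
  -- except in its block for class 1 belong to P.
  leave-Q : (r : ↑ (P ∪ Q) ≤¹₁ ↑ (P ⌢⟨ index 0F ⟩ Q)) → ∃[ f ] P f × ∃[ u ] (proj₁ r ⟨ seq f ⟩≃ seq u) × ¬ Q u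
  leave-Q r@(e , _) = ¬¬-elim λ none → diagonal e 1F λ f S →
    let Pf = safe⇒class em 1F (code e) S
        (u , D , _) = reduces {P ∪ Q} r f (inj₁ Pf)
    in u , D , ¬¬-elim λ ¬Qu → none (f , Pf , u , D , ¬Qu)

  -- P has empty interior: if all continuations of a string were in P, prepending that string would
  -- map every sequence into P, against `diagonal`.
  leave-P : ∀ h n → ∃[ f ] (∀ x → x < n → f x ≡ h x) × ¬ P f
  leave-P h n = ¬¬-elim λ none → diagonal (splice ρ 0) 0F λ f _ →
    ρ ⌢ f , ⇓-splice ρ 0 f , ¬¬-elim λ ¬P → none (ρ ⌢ f , (λ x → ⌢-< h n f) , ¬P)
    where
    ρ : String
    ρ = applyUpTo h n

  -- A sequence outside P that shares n bits with h cannot leave the tree before length n, and the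
  -- last string it has in the tree is a leaf.
  leaf-above : ∀ h n → P h → ∃[ ρ ] Leaf (Tree 0F) ρ × (∀ f x → x < n → (ρ ⌢ f) x ≡ h x)
  leaf-above h n Ph with leave-P h n
  ... | f , eq , ¬Pf with exit {0F} {f} ¬Pf
  ... | m , T , ¬T with n ≤? m
  ... | yes n≤m = applyUpTo f m , leaf 0F f m T ¬T , λ f′ x x<n → trans (⌢-< f m f′ (<-≤-trans x<n n≤m)) (eq x x<n)
  ... | no n≰m  = contradiction
    (subst (Tree 0F) (applyUpTo-cong (suc m) λ x x≤m → sym (eq x (<-≤-trans x≤m (≰⇒> n≰m)))) (Ph (suc m))) ¬T

  stays-in-P : ∀ u {u′ n} → ¬ Tree 1F (applyUpTo u n) → (∀ x → x < n → u x ≡ u′ x) → (P ∪ Q) u′ → P u′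
  stays-in-P u {u′} {n} ¬T eq (inj₁ Pu′) = Pu′
  stays-in-P u {u′} {n} ¬T eq (inj₂ Qu′) =
    contradiction (subst (Tree 1F) (applyUpTo-cong n λ x x<n → sym (eq x x<n)) (Qu′ n)) ¬T

  P∪Q≰P⌢Q : ¬ (↑ (P ∪ Q) ≤¹₁ ↑ (P ⌢⟨ index 0F ⟩ Q))
  P∪Q≰P⌢Q r@(e , _) =
    let (f , Pf , u , D , ¬Qu)   = leave-Q r
        (n , ¬T)                 = ¬∀⇒∃¬ ¬Qu
        (U , same)               = use em {e = e} D n
        (ρ , ρ-leaf , above)     = leaf-above f U Pf
    -- Each q in Q yields an element ρ ⌢ q of P ⌢ Q. Its image shares with u the n bits that exclude
    -- membership in Q, so it lies in P.
    in diagonal (e [ splice ρ 0 ]) 0F λ q S →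
      let (u′ , D′ , PQu′) = reduces {P ∪ Q} r (ρ ⌢ q) (inj₂
            (ρ , ρ-leaf , q , safe⇒class em 0F (code (e [ splice ρ 0 ])) S , λ _ → refl))
      in u′ , (λ x → ⇓-[] (⇓-splice ρ 0 q) (D′ x)) , stays-in-P u ¬T (λ x x<n →
        toℕ-injective (same {h′ = seq u′} (λ a a<U → cong toℕ (above q a a<U)) D′ x x<n)) PQu′

-- The reduction of P ⌢ Q to P ∪ Q

-- The variables are n d.
belowR : Rel 2
belowR = ⟪ all (v 0) (app (admitsR 0F) (v 0 ∷ v 2 ∷ [])) ⟫

Below : ℕ → ℕ → Set
Below n d = rel belowR (n ∷ d ∷ [])

-- Stage k reads only k bits, so m bits decide membership in the tree up to length m + 1.
Below⇔Tree : ∀ f {n m} → n ≤ suc m → (Below n ⌜ applyUpTo f m ⌝ → Tree 0F (applyUpTo f n)) ×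
                                    (Tree 0F (applyUpTo f n) → Below n ⌜ applyUpTo f m ⌝)
Below⇔Tree f {n} {m} n≤1+m =
  (λ B → Admits⇒Tree 0F f {n} λ k k<n → Admits-agree (agree-≤ (s≤s⁻¹ (≤-trans k<n n≤1+m)) (bin-applyUpTo f m)) (B k k<n)) ,
  λ T k k<n → Admits-agree (agree-≤ (s≤s⁻¹ (≤-trans k<n n≤1+m)) (agree-sym (bin-applyUpTo f m))) (Tree⇒Admits 0F f {n} T k<n)

-- The variables are x d, where d codes the first x + 1 bits of an element of P ∪ Q;
-- bit x of the corresponding element of P ⌢ Q is to be 1.
outputR : Rel 2
outputR = ⟪ (app belowR (1+ v 0 ∷ v 1 ∷ []) ⇒ bin′ (v 1) (v 0) ≐ num 1) ∧
            all (1+ v 0) (app belowR (v 0 ∷ v 2 ∷ []) ⇒ ∼ app belowR (1+ v 0 ∷ v 2 ∷ []) ⇒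
                          bin′ (v 2) (v 1 ∸̇ v 0) ≐ num 1) ⟫

One : ℕ → Cantor → Set
One x f = rel outputR (x ∷ ⌜ applyUpTo f (suc x) ⌝ ∷ [])

-- The head of a string is the least significant digit, so an appended bit is a new leading digit, 1
-- or 2.
∷ʳ-code : ∀ σ b → ⌜ σ ++ b ∷ [] ⌝ ≡ ⌜ σ ⌝ + suc (toℕ b) * 2 ^ length σ
∷ʳ-code []      b = cong suc (trans (+-identityʳ (toℕ b)) (sym (*-identityʳ (toℕ b))))
∷ʳ-code (c ∷ σ) b = cong suc (begin
  toℕ c + 2 * ⌜ σ ++ b ∷ [] ⌝             ≡⟨ cong (λ n → toℕ c + 2 * n) (∷ʳ-code σ b) ⟩
  toℕ c + 2 * (⌜ σ ⌝ + B * 2 ^ l)         ≡⟨ cong (toℕ c +_) (*-distribˡ-+ 2 ⌜ σ ⌝ (B * 2 ^ l)) ⟩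
  toℕ c + (2 * ⌜ σ ⌝ + 2 * (B * 2 ^ l))   ≡⟨ +-assoc (toℕ c) _ _ ⟨
  toℕ c + 2 * ⌜ σ ⌝ + 2 * (B * 2 ^ l)     ≡⟨ cong (toℕ c + 2 * ⌜ σ ⌝ +_) (x∙yz≈y∙xz *-commutativeSemigroup 2 B (2 ^ l)) ⟩
  toℕ c + 2 * ⌜ σ ⌝ + B * (2 * 2 ^ l)     ∎)
  where
  open ≡-Reasoning
  B = suc (toℕ b)
  l = length σ

prefix-code : Rec ⊤ 1
prefix-code = prec zero (comp (compile (v 2 ∔ 1+ v 0 ∗ app 2^ᶠ (v 1 ∷ [])))
  (comp (oracle tt) (proj 0F ∷ []) ∷ proj 0F ∷ proj 1F ∷ []))

⇓-prefix-code : ∀ {g} f → g ≗ seq f → ∀ n → (λ _ → g) ⊢ prefix-code · Vec.[ n ] ⇓ ⌜ applyUpTo f n ⌝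
⇓-prefix-code f eq zero    = ⇓-prec₀ ⇓-zero
⇓-prefix-code f eq (suc n) = ⇓-prec₊ (⇓-prefix-code f eq n) (⇓-comp {ys = seq f n ∷ n ∷ ⌜ applyUpTo f n ⌝ ∷ []}
  (λ { 0F → ⇓-comp {ys = n ∷ []} (λ { 0F → ⇓-proj }) (⇓-resp (eq n) ⇓-oracle) ; 1F → ⇓-proj ; 2F → ⇓-proj })
  (⇓-resp step (⇓-compile (v 2 ∔ 1+ v 0 ∗ app 2^ᶠ (v 1 ∷ [])) _)))
  where
  step : ⌜ applyUpTo f n ⌝ + suc (seq f n) * 2 ^ n ≡ ⌜ applyUpTo f (suc n) ⌝
  step = begin
    ⌜ applyUpTo f n ⌝ + suc (seq f n) * 2 ^ n
      ≡⟨ cong (λ l → ⌜ applyUpTo f n ⌝ + suc (seq f n) * 2 ^ l) (length-applyUpTo f n) ⟨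
    ⌜ applyUpTo f n ⌝ + suc (seq f n) * 2 ^ length (applyUpTo f n) ≡⟨ ∷ʳ-code (applyUpTo f n) (f n) ⟨
    ⌜ applyUpTo f n ++ f n ∷ [] ⌝                                  ≡⟨ cong ⌜_⌝ (applyUpTo-∷ʳ f n) ⟩
    ⌜ applyUpTo f (suc n) ⌝                                        ∎
    where open ≡-Reasoning

reduction : Rec ⊤ 1
reduction = comp (prog (char outputR)) (proj 0F ∷ comp prefix-code (suc ∷ []) ∷ [])

⇓-reduction : ∀ {g} f h → g ≗ seq f → (∀ x → One x f → h x ≡ 1F) → (∀ x → h x ≡ 1F → One x f) →
              reduction ⟨ g ⟩≃ seq h
⇓-reduction f h eq sound complete x = ⇓-comp {ys = x ∷ d ∷ []}
  (λ { 0F → ⇓-proj ; 1F → ⇓-comp {ys = suc x ∷ []} (λ { 0F → ⇓-suc }) (⇓-prefix-code f eq (suc x)) })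
  (⇓-resp (lem (h x) refl (spec outputR (x ∷ d ∷ []))) (correct (char outputR) (x ∷ d ∷ [])))
  where
  d : ℕ
  d = ⌜ applyUpTo f (suc x) ⌝
  lem : ∀ b {c} → h x ≡ b → Reflects01 (One x f) c → c ≡ toℕ (h x)
  lem b  eq (inj₁ (one , refl))  = cong toℕ (sym (sound x one))
  lem 0F eq (inj₂ (¬one , refl)) = cong toℕ (sym eq)
  lem 1F eq (inj₂ (¬one , refl)) = contradiction (complete x eq) ¬one

-- As long as f is in the tree no exit occurs, so the second clause of `outputR` is vacuous and the
-- first copies f.
One-in : ∀ {x f} → Tree 0F (applyUpTo f (suc x)) → (One x f → f x ≡ 1F) × (f x ≡ 1F → One x f)
One-in {x} {f} T =
  (λ (o , _) → toℕ-injective (trans (sym (bin-applyUpTo f (suc x) x ≤-refl)) (o (proj₂ (Below⇔Tree f (n≤1+n _)) T)))) ,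
  λ eq → (λ _ → trans (bin-applyUpTo f (suc x) x ≤-refl) (cong toℕ eq)) ,
    λ m m≤x _ ¬B → contradiction (proj₂ (Below⇔Tree f (s≤s (<⇒≤ m≤x))) (Tree-≤ 0F f m≤x T)) ¬B

-- After the exit the first clause is vacuous. A tree is left only once, so the second clause speaks
-- of m alone and restarts f there.
One-out : ∀ {x f m} → m ≤ x → Tree 0F (applyUpTo f m) → ¬ Tree 0F (applyUpTo f (suc m)) →
          (One x f → f (x ∸ m) ≡ 1F) × (f (x ∸ m) ≡ 1F → One x f)
One-out {x} {f} {m} m≤x T ¬T =
  (λ (_ , o) → toℕ-injective (trans (sym (bin-applyUpTo f (suc x) (x ∸ m) (s≤s (m∸n≤m x m))))
    (o m (s≤s m≤x) (proj₂ (Below⇔Tree f (≤-trans m≤x (≤-trans (n≤1+n x) (n≤1+n _)))) T)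
      (¬T ∘ proj₁ (Below⇔Tree f (s≤s (≤-trans m≤x (n≤1+n x)))))))) ,
  λ eq → (λ B → contradiction (Tree-≤ 0F f (s≤s m≤x) (proj₁ (Below⇔Tree f (n≤1+n _)) B)) ¬T) ,
    λ k k≤x B ¬B → trans (bin-applyUpTo f (suc x) (x ∸ k) (s≤s (m∸n≤m x k)))
      (trans (cong (λ l → seq f (x ∸ l)) (unique k (proj₁ (Below⇔Tree f (m≤n⇒m≤1+n (<⇒≤ k≤x))) B)
        (¬B ∘ proj₂ (Below⇔Tree f (s≤s (<⇒≤ k≤x)))))) (cong toℕ eq))
  where
  unique : ∀ k → Tree 0F (applyUpTo f k) → ¬ Tree 0F (applyUpTo f (suc k)) → k ≡ m
  unique k Tₖ ¬Tₖ with <-cmp k m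
  ... | tri< k<m _ _ = contradiction (Tree-≤ 0F f k<m T) ¬Tₖ
  ... | tri≈ _ k≡m _ = k≡m
  ... | tri> _ _ m<k = contradiction (Tree-≤ 0F f m<k Tₖ) ¬T

One-⌢ : ∀ {f m} → Tree 0F (applyUpTo f m) → ¬ Tree 0F (applyUpTo f (suc m)) → ∀ x →
        (One x f → (applyUpTo f m ⌢ f) x ≡ 1F) × ((applyUpTo f m ⌢ f) x ≡ 1F → One x f)
One-⌢ {f} {m} T ¬T x with suc x ≤? m
... | yes x<m = let (to , from) = One-in {f = f} (Tree-≤ 0F f x<m T); eq = ⌢-< f m f x<m in
  trans eq ∘ to , from ∘ trans (sym eq)
... | no x≮m  = let m≤x = s≤s⁻¹ (≰⇒> x≮m)
                    (to , from) = One-out {f = f} m≤x T ¬T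
                    eq = trans (cong (applyUpTo f m ⌢ f) (sym (m+[n∸m]≡n m≤x))) (⌢-+ f m f (x ∸ m)) in
  trans eq ∘ to , from ∘ trans (sym eq)

module _ (em : ExcludedMiddle 0ℓ) where

  -- The program is the same in both cases; whether f is in P only determines which sequence it is
  -- shown to produce.
  reduce : ∀ {g f} → (P ∪ Q) f → g ≗ seq f → Dec (P f) →
           ∃[ h ] (reduction ⟨ g ⟩≃ seq h) × (P ⌢⟨ index 0F ⟩ Q) h
  reduce {f = f} PQ eq (yes Pf) = f ,
    ⇓-reduction f f eq (λ x → proj₁ (One-in {f = f} (Pf (suc x)))) (λ x → proj₂ (One-in {f = f} (Pf (suc x)))) ,
    inj₁ Pf
  reduce (inj₁ Pf) eq (no ¬Pf) = contradiction Pf ¬Pf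
  reduce {f = f} (inj₂ Qf) eq (no ¬Pf) = let (m , T , ¬T) = exit em {0F} {f} ¬Pf in
    applyUpTo f m ⌢ f ,
    ⇓-reduction f (applyUpTo f m ⌢ f) eq (λ x → proj₁ (One-⌢ {f} {m} T ¬T x)) (λ x → proj₂ (One-⌢ {f} {m} T ¬T x)) ,
    inj₂ (applyUpTo f m , leaf 0F f m T ¬T , f , Qf , λ _ → refl)

  P⌢Q≤P∪Q : ↑ (P ⌢⟨ index 0F ⟩ Q) ≤¹₁ ↑ (P ∪ Q)
  P⌢Q≤P∪Q = reduction , λ g (f , PQ , eq) → let (h , D , PQh) = reduce PQ eq em in
    seq h , D , h , PQh , λ _ → refl

corollary7 : ExcludedMiddle 0ℓ →
    Σ[ P ∈ Pred Cantor 0ℓ ] Σ[ Q ∈ Pred Cantor 0ℓ ]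
    Σ[ p ∈ Π⁰₁ P ] Σ[ q ∈ Π⁰₁ Q ]
      (↑ (P ⌢⟨ p ⟩ Q) <¹₁ ↑ (P ∪ Q)) × (↑ (P ∪ Q) <¹₁ ↑ (P ⊕ Q))
corollary7 em = P , Q , index 0F , index 1F ,
  (P⌢Q≤P∪Q em , P∪Q≰P⌢Q em) , (P∪Q≤P⊕Q , P⊕Q≰P∪Q em)
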